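{- For each positive integer $n$, let $a(n)$ be the number of $6 \times 2n$ matrices with entries in $\{0,1\}$ such that every row contains exactly $n$ ones and every column contains exactly $3$ ones. Then for all positive integers $n$, \begin{align*} & 51200 (2n+7)(2n+5)(2n+3)(2n+1)(n+2)(n+1)\bigl(33n^2+242n+445\bigr)\, a(n) \\ & - 128 (2n+7)(2n+5)(2n+3)(n+2)\bigl(7491n^4+84898n^3+351364n^2+628997n+414370\bigr)\, a(n+1) \\ & + 16 (2n+5)(2n+7)\bigl(2772n^6+48048n^5+344379n^4+1307394n^3+2775099n^2+3125336n+1460132\bigr)\, a(n+2) \\ & + 2(2n+7)(n+3)\bigl(3201n^6+61886n^5+497179n^4+2124170n^3+5089654n^2+6484024n+3431096\bigr)\, a(n+3) \\ & - (n+3)(n+4)^5\bigl(33n^2+176n+236\bigr)\, a(n+4) = 0. \end{align*} -}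

module Defs where

open import Data.Nat using (ℕ; zero; suc; _+_; _*_; _≟_)
open import Data.Bool using (Bool; true; false)
open import Data.Vec using (Vec; []; _∷_; foldr; map; zipWith; replicate)
open import Data.List as List using (List; []; _∷_; length; filter; concatMap)
open import Data.Product using (_×_; _,_)
open import Relation.Nullary using (Dec)
open import Relation.Nullary.Decidable using (_×-dec_)
open import Relation.Binary.PropositionalEquality using (_≡_)

Matrix01 : ℕ → ℕ → Set
Matrix01 r c = Vec (Vec Bool c) r

bit : Bool → ℕ
bit true  = 1
bit false = 0

ones : ∀ {c} → Vec Bool c → ℕ
ones = foldr _ (λ b s → bit b + s) 0

colSums : ∀ {r c} → Matrix01 r c → Vec ℕ c
colSums {c = c} = foldr _ (λ row acc → zipWith _+_ (map bit row) acc) (replicate c 0)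

AllEq : ∀ {m} → ℕ → Vec ℕ m → Set
AllEq k []       = Data.Unit.⊤ where import Data.Unit
AllEq k (x ∷ xs) = (x ≡ k) × AllEq k xs

allEq? : ∀ {m} (k : ℕ) (xs : Vec ℕ m) → Dec (AllEq k xs)
allEq? k []       = Relation.Nullary.yes _ where import Relation.Nullary
allEq? k (x ∷ xs) = (x ≟ k) ×-dec allEq? k xs

Good : (n : ℕ) → Matrix01 6 (2 * n) → Set
Good n M = AllEq n (map ones M) × AllEq 3 (colSums M)

good? : (n : ℕ) (M : Matrix01 6 (2 * n)) → Dec (Good n M)
good? n M = allEq? n (map ones M) ×-dec allEq? 3 (colSums M)

allVecs : (c : ℕ) → List (Vec Bool c)
allVecs zero    = [] ∷ []
allVecs (suc c) = concatMap (λ v → (true ∷ v) ∷ (false ∷ v) ∷ []) (allVecs c)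

allMatrices : (r c : ℕ) → List (Matrix01 r c)
allMatrices zero    c = [] ∷ []
allMatrices (suc r) c =
  concatMap (λ M → List.map (λ row → row ∷ M) (allVecs c)) (allMatrices r c)

a : ℕ → ℕ
a n = length (filter (good? n) (allMatrices 6 (2 * n)))

-- Write e₁, …, e₆ for the elementary symmetric polynomials in x₁, …, x₆.  Reading a matrix column
-- by column, a(n) is the coefficient of (x₁⋯x₆)ⁿ in e₃²ⁿ.  For every polynomial f, comparing
-- coefficients of (x₁⋯x₆)ᵐ in Σᵢ xᵢ∂ᵢ(xᵢᵏ f) shows that Dₖf and (m − k)·pₖ·f have the same
-- coefficient there, where Dₖ = Σᵢ xᵢᵏ⁺¹∂ᵢ and pₖ = Σᵢ xᵢᵏ.  Since
--   D₁eⱼ = e₁eⱼ − (j+1)eⱼ₊₁   and   D₂eⱼ = p₂eⱼ − e₁eⱼ₊₁ + (j+2)eⱼ₊₂,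
-- each monomial f in the eⱼ gives a linear relation between the coefficients of such monomials, and
-- the reflection xᵢ ↦ xᵢ⁻¹ identifies these coefficients in pairs.  Explicit combinations of
-- relations over ℤ[n] yield two recurrences between a(n) and b(n) = [(x₁⋯x₆)ⁿ⁺¹] e₂e₄e₃²ⁿ, and
-- eliminating b from shifts of these two gives 6(n+2) times the claimed recurrence.

module Submission where

open import Defs
open import Algebra.Bundles using (CommutativeRing)
open import Data.Bool using (Bool; true; false; if_then_else_; _∧_; _∨_)
open import Data.Fin using (Fin; zero; suc; toℕ; fromℕ<)
import Data.Fin.Properties as Finₚ
open import Data.List as List using (List; []; _∷_; _++_; length; filter; concatMap)
import Data.List.Properties as Listₚ
open import Data.List.Relation.Binary.Pointwise as Pointwise using (Pointwise; []; _∷_; Pointwise-length)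
open import Data.List.Relation.Unary.All using (All; []; _∷_)
open import Data.Nat as ℕ using (ℕ; zero; suc; _∸_) renaming (_+_ to _+ℕ_)
import Data.Nat.Properties as ℕₚ
import Data.Nat.Tactic.RingSolver as ℕ-Solver
open import Data.Product using (_×_; _,_; proj₁; proj₂)
open import Data.Sum using (_⊎_; inj₁; inj₂)
import Data.Sum.Properties as Sumₚ
open import Data.Vec as Vec using (Vec; []; _∷_; lookup; zipWith; replicate; tabulate)
import Data.Vec.Properties as Vecₚ
open import Function using (_∘_)
open import Level using (0ℓ)
open import Relation.Binary.Definitions using (DecidableEquality)
import Relation.Binary.PropositionalEquality as ≡
open import Relation.Nullary using (Dec; yes; no; does; contradiction)
open import Relation.Nullary.Decidable using (_×-dec_)
open import Relation.Unary using (Decidable)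
open ≡ using (_≡_)

-- Elementary symmetric polynomials in a commutative ring

-- In every monomial that occurs, the exponent of e₃ is 2n plus a small constant and all other
-- exponents are small constants. Hence each relation involves finitely many monomials, with
-- coefficients of degree at most one in n, and one finite linear system over ℤ[n] serves all n at
-- once. The factor e₆ = x₁⋯x₆ only shifts the index of the coefficient, so all coefficients can be
-- read at the single index n + 5. The solutions of the system are long; they are supplied as data,
-- and the cancellation of the unwanted monomials is decided by a normaliser for linear forms that
-- is proved sound. The reflection needs negative exponents, so the setting is Laurent polynomials.
-- They are used as operators on functions from ℤ^ρ to ℤ, which turns taking coefficients,
-- differentiating and reflecting into identities between operators.

module Elementary {c ℓ} (R : CommutativeRing c ℓ) where
  open CommutativeRing R hiding (zero)
  open import Algebra.Solver.Ring.NaturalCoefficients.Default commutativeSemiring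
    using (solve; _:=_; _:+_; _:*_) renaming (con to :con)
  open import Relation.Binary.Reasoning.Setoid setoid

  e : List Carrier → ℕ → Carrier
  e _        zero    = 1#
  e []       (suc j) = 0#
  e (x ∷ xs) (suc j) = e xs (suc j) + x * e xs j

  p₁ p₂ : List Carrier → Carrier
  p₁ []       = 0#
  p₁ (x ∷ xs) = x + p₁ xs
  p₂ []       = 0#
  p₂ (x ∷ xs) = x * x + p₂ xs

  -- The derivation of e xs j that sends each x of xs to v x.
  ∂e : (Carrier → Carrier) → List Carrier → ℕ → Carrier
  ∂e v _        zero    = 0#
  ∂e v []       (suc j) = 0#
  ∂e v (x ∷ xs) (suc j) = ∂e v xs (suc j) + (v x * e xs j + x * ∂e v xs j)

  nat : ℕ → Carrier
  nat zero    = 0#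
  nat (suc n) = 1# + nat n

  e₁≈p₁ : ∀ xs → e xs 1 ≈ p₁ xs
  e₁≈p₁ []       = refl
  e₁≈p₁ (x ∷ xs) = trans (+-cong (e₁≈p₁ xs) (*-identityʳ x)) (+-comm _ _)

  -- Newton's identity p₂ = e₁² - 2e₂, kept free of subtraction because the solver normalises over
  -- commutative semirings. The identities for `∂e` below are arranged in the same way.
  p₂+2e₂ : ∀ xs → p₂ xs + (e xs 2 + e xs 2) ≈ p₁ xs * p₁ xs
  p₂+2e₂ []       = solve 0 (:con 0 :+ (:con 0 :+ :con 0) := :con 0 :* :con 0) refl
  p₂+2e₂ (x ∷ xs) = begin
    (x * x + p₂ xs) + ((e xs 2 + x * e xs 1) + (e xs 2 + x * e xs 1))
      ≈⟨ solve 4 (λ x p a b → (x :* x :+ p) :+ ((a :+ x :* b) :+ (a :+ x :* b))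
                   := (p :+ (a :+ a)) :+ (x :* x :+ (x :* b :+ x :* b))) refl x (p₂ xs) (e xs 2) (e xs 1) ⟩
    (p₂ xs + (e xs 2 + e xs 2)) + (x * x + (x * e xs 1 + x * e xs 1))
      ≈⟨ +-cong (p₂+2e₂ xs) (+-congˡ (+-cong (*-congˡ (e₁≈p₁ xs)) (*-congˡ (e₁≈p₁ xs)))) ⟩
    p₁ xs * p₁ xs + (x * x + (x * p₁ xs + x * p₁ xs))
      ≈⟨ solve 2 (λ x p → p :* p :+ (x :* x :+ (x :* p :+ x :* p)) := (x :+ p) :* (x :+ p)) refl x (p₁ xs) ⟩
    (x + p₁ xs) * (x + p₁ xs) ∎

  -- Multiply a squarefree monomial of degree j by a variable. If the variable already occurs, the
  -- product is a term of the derivative. Otherwise it is squarefree of degree j + 1, and each such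
  -- monomial arises in j + 1 ways.
  ∂₁e : ∀ xs j → ∂e (λ x → x * x) xs j + nat (suc j) * e xs (suc j) ≈ p₁ xs * e xs j
  ∂₁e []       zero    = solve 0 (:con 0 :+ (:con 1 :+ :con 0) :* :con 0 := :con 0 :* :con 1) refl
  ∂₁e []       (suc j) = solve 1 (λ n → :con 0 :+ n :* :con 0 := :con 0 :* :con 0) refl (nat (suc (suc j)))
  ∂₁e (x ∷ xs) zero    = begin
    0# + (1# + 0#) * (e xs 1 + x * 1#)
      ≈⟨ solve 2 (λ a x → :con 0 :+ (:con 1 :+ :con 0) :* (a :+ x :* :con 1) := (x :+ a) :* :con 1) refl (e xs 1) x ⟩
    (x + e xs 1) * 1#
      ≈⟨ *-congʳ (+-congˡ (e₁≈p₁ xs)) ⟩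
    (x + p₁ xs) * 1# ∎
  ∂₁e (x ∷ xs) (suc j) = begin
    (d₁ + (x * x * e₀ + x * d₀)) + (1# + n) * (e₂ + x * e₁)
      ≈⟨ solve 7 (λ x d₀ d₁ e₀ e₁ e₂ n →
           (d₁ :+ (x :* x :* e₀ :+ x :* d₀)) :+ (:con 1 :+ n) :* (e₂ :+ x :* e₁)
           := (d₁ :+ (:con 1 :+ n) :* e₂) :+ x :* (d₀ :+ n :* e₁) :+ (x :* x :* e₀ :+ x :* e₁))
         refl x d₀ d₁ e₀ e₁ e₂ n ⟩
    (d₁ + (1# + n) * e₂) + x * (d₀ + n * e₁) + (x * x * e₀ + x * e₁)
      ≈⟨ +-congʳ (+-cong (∂₁e xs (suc j)) (*-congˡ (∂₁e xs j))) ⟩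
    p₁ xs * e₁ + x * (p₁ xs * e₀) + (x * x * e₀ + x * e₁)
      ≈⟨ solve 4 (λ x p e₀ e₁ →
           p :* e₁ :+ x :* (p :* e₀) :+ (x :* x :* e₀ :+ x :* e₁)
           := (x :+ p) :* (e₁ :+ x :* e₀)) refl x (p₁ xs) e₀ e₁ ⟩
    (x + p₁ xs) * (e₁ + x * e₀) ∎
    where
    n = nat (suc j)
    d₀ = ∂e (λ x → x * x) xs j
    d₁ = ∂e (λ x → x * x) xs (suc j)
    e₀ = e xs j
    e₁ = e xs (suc j)
    e₂ = e xs (suc (suc j))

  -- Let M be the sum of all monomials with one variable squared and j others to the first power.
  -- Then p₂eⱼ is the derivative plus M, and p₁eⱼ₊₁ is M plus (j+2)eⱼ₊₂; eliminating M gives the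
  -- identity.
  ∂₂e : ∀ xs j → ∂e (λ x → x * (x * x)) xs j + p₁ xs * e xs (suc j)
                 ≈ p₂ xs * e xs j + nat (suc (suc j)) * e xs (suc (suc j))
  ∂₂e []       zero    =
    solve 0 (:con 0 :+ :con 0 :* :con 0 := :con 0 :* :con 1 :+ (:con 1 :+ (:con 1 :+ :con 0)) :* :con 0) refl
  ∂₂e []       (suc j) =
    solve 1 (λ n → :con 0 :+ :con 0 :* :con 0 := :con 0 :* :con 0 :+ n :* :con 0) refl (nat (suc (suc (suc j))))
  ∂₂e (x ∷ xs) zero    = begin
    0# + (x + p₁ xs) * (e xs 1 + x * 1#)
      ≈⟨ +-congˡ (*-congˡ (+-congʳ (e₁≈p₁ xs))) ⟩
    0# + (x + p₁ xs) * (p₁ xs + x * 1#)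
      ≈⟨ solve 2 (λ x p → :con 0 :+ (x :+ p) :* (p :+ x :* :con 1)
                    := p :* p :+ (x :* x :+ (x :* p :+ x :* p))) refl x (p₁ xs) ⟩
    p₁ xs * p₁ xs + (x * x + (x * p₁ xs + x * p₁ xs))
      ≈⟨ +-cong (p₂+2e₂ xs) (+-congˡ (+-cong (*-congˡ (e₁≈p₁ xs)) (*-congˡ (e₁≈p₁ xs)))) ⟨
    (p₂ xs + (e xs 2 + e xs 2)) + (x * x + (x * e xs 1 + x * e xs 1))
      ≈⟨ solve 4 (λ x p a b → (p :+ (a :+ a)) :+ (x :* x :+ (x :* b :+ x :* b))
           := (x :* x :+ p) :* :con 1 :+ (:con 1 :+ (:con 1 :+ :con 0)) :* (a :+ x :* b))
         refl x (p₂ xs) (e xs 2) (e xs 1) ⟩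
    (x * x + p₂ xs) * 1# + (1# + (1# + 0#)) * (e xs 2 + x * e xs 1) ∎
  ∂₂e (x ∷ xs) (suc j) = begin
    (d₁ + (x * (x * x) * e₀ + x * d₀)) + (x + q₁) * (e₂ + x * e₁)
      ≈⟨ solve 7 (λ x d₀ d₁ e₀ e₁ e₂ q₁ →
           (d₁ :+ (x :* (x :* x) :* e₀ :+ x :* d₀)) :+ (x :+ q₁) :* (e₂ :+ x :* e₁)
           := (d₁ :+ q₁ :* e₂) :+ x :* (d₀ :+ q₁ :* e₁) :+ (x :* x :* (x :* e₀ :+ e₁) :+ x :* e₂))
         refl x d₀ d₁ e₀ e₁ e₂ q₁ ⟩
    (d₁ + q₁ * e₂) + x * (d₀ + q₁ * e₁) + (x * x * (x * e₀ + e₁) + x * e₂)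
      ≈⟨ +-congʳ (+-cong (∂₂e xs (suc j)) (*-congˡ (∂₂e xs j))) ⟩
    (q₂ * e₁ + (1# + n) * e₃) + x * (q₂ * e₀ + n * e₂) + (x * x * (x * e₀ + e₁) + x * e₂)
      ≈⟨ solve 7 (λ x q₂ e₀ e₁ e₂ e₃ n →
           (q₂ :* e₁ :+ (:con 1 :+ n) :* e₃) :+ x :* (q₂ :* e₀ :+ n :* e₂)
             :+ (x :* x :* (x :* e₀ :+ e₁) :+ x :* e₂)
           := (x :* x :+ q₂) :* (e₁ :+ x :* e₀) :+ (:con 1 :+ n) :* (e₃ :+ x :* e₂))
         refl x q₂ e₀ e₁ e₂ e₃ n ⟩
    (x * x + q₂) * (e₁ + x * e₀) + (1# + n) * (e₃ + x * e₂) ∎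
    where
    n = nat (suc (suc j))
    q₁ = p₁ xs
    q₂ = p₂ xs
    d₀ = ∂e (λ x → x * (x * x)) xs j
    d₁ = ∂e (λ x → x * (x * x)) xs (suc j)
    e₀ = e xs j
    e₁ = e xs (suc j)
    e₂ = e xs (suc (suc j))
    e₃ = e xs (suc (suc (suc j)))

  prod : List Carrier → Carrier
  prod []       = 1#
  prod (x ∷ xs) = x * prod xs

  e-vanishes : ∀ xs k → e xs (suc (length xs +ℕ k)) ≈ 0#
  e-vanishes []       k = refl
  e-vanishes (x ∷ xs) k = begin
    e xs (suc (suc (length xs +ℕ k))) + x * e xs (suc (length xs +ℕ k))
      ≡⟨ ≡.cong (λ l → e xs (suc l) + x * e xs (suc (length xs +ℕ k))) (≡.sym (ℕₚ.+-suc (length xs) k)) ⟩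
    e xs (suc (length xs +ℕ suc k)) + x * e xs (suc (length xs +ℕ k))
      ≈⟨ +-cong (e-vanishes xs (suc k)) (*-congˡ (e-vanishes xs k)) ⟩
    0# + x * 0#
      ≈⟨ solve 1 (λ x → :con 0 :+ x :* :con 0 := :con 0) refl x ⟩
    0# ∎

  -- Passing to complements of subsets: a product of j of the variables is the product of all of
  -- them times the inverses of the remaining l.
  e-reciprocal : ∀ {xs ys} → Pointwise (λ x y → x * y ≈ 1#) xs ys →
                 ∀ j l → j +ℕ l ≡ length xs → e xs j ≈ prod xs * e ys l
  e-reciprocal [] zero zero _ = sym (*-identityˡ 1#)
  e-reciprocal (_∷_ {x} {y} {xs} {ys} xy inv) zero (suc l) eq = begin
    1#
      ≈⟨ *-identityˡ 1# ⟨
    1# * 1#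
      ≈⟨ *-cong xy (sym (e-reciprocal inv 0 l (ℕₚ.suc-injective eq))) ⟨
    (x * y) * (prod xs * e ys l)
      ≈⟨ solve 4 (λ x y p a → (x :* y) :* (p :* a) := (x :* p) :* (:con 0 :+ y :* a)) refl x y (prod xs) (e ys l) ⟩
    (x * prod xs) * (0# + y * e ys l)
      ≈⟨ *-congˡ (+-congʳ (e-vanishes ys 0)) ⟨
    (x * prod xs) * (e ys (suc (length ys +ℕ 0)) + y * e ys l)
      ≡⟨ ≡.cong (λ k → (x * prod xs) * (e ys (suc k) + y * e ys l))
           (≡.trans (ℕₚ.+-identityʳ _) (≡.trans (≡.sym (Pointwise-length inv)) (≡.sym (ℕₚ.suc-injective eq)))) ⟩
    (x * prod xs) * (e ys (suc l) + y * e ys l) ∎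
  e-reciprocal (_∷_ {x} {y} {xs} {ys} xy inv) (suc j) zero eq = begin
    e xs (suc j) + x * e xs j
      ≡⟨ ≡.cong (λ k → e xs (suc k) + x * e xs j) (≡.trans (≡.sym (ℕₚ.+-identityʳ j))
           (≡.trans (ℕₚ.suc-injective eq) (≡.sym (ℕₚ.+-identityʳ (length xs))))) ⟩
    e xs (suc (length xs +ℕ 0)) + x * e xs j
      ≈⟨ +-cong (e-vanishes xs 0) (*-congˡ (e-reciprocal inv j 0 (ℕₚ.suc-injective eq))) ⟩
    0# + x * (prod xs * 1#)
      ≈⟨ solve 2 (λ x p → :con 0 :+ x :* (p :* :con 1) := (x :* p) :* :con 1) refl x (prod xs) ⟩
    (x * prod xs) * 1# ∎
  e-reciprocal (_∷_ {x} {y} {xs} {ys} xy inv) (suc j) (suc l) eq = begin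
    e xs (suc j) + x * e xs j
      ≈⟨ +-cong (e-reciprocal inv (suc j) l (≡.trans (≡.sym (ℕₚ.+-suc j l)) (ℕₚ.suc-injective eq)))
                (*-congˡ (e-reciprocal inv j (suc l) (ℕₚ.suc-injective eq))) ⟩
    prod xs * e ys l + x * (prod xs * e ys (suc l))
      ≈⟨ +-congʳ (trans (*-congʳ xy) (*-identityˡ _)) ⟨
    (x * y) * (prod xs * e ys l) + x * (prod xs * e ys (suc l))
      ≈⟨ solve 5 (λ x y p a b → (x :* y) :* (p :* a) :+ x :* (p :* b) := (x :* p) :* (b :+ y :* a))
           refl x y (prod xs) (e ys l) (e ys (suc l)) ⟩
    (x * prod xs) * (e ys (suc l) + y * e ys l) ∎

open import Data.Integer using (ℤ; NonZero; +_; -_; _+_; _-_; _*_)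
import Data.Integer.Properties as ℤₚ
open import Data.Integer.Tactic.RingSolver using (solve-∀)
open import Algebra.Properties.CommutativeMonoid.Sum ℤₚ.+-0-commutativeMonoid
  using (sum; sum-cong-≗; sum-replicate-zero; ∑-distrib-+)
open import Algebra.Properties.Semiring.Sum ℤₚ.+-*-semiring using (*-distribˡ-sum)
open ≡ using (refl; sym; trans; cong; cong₂; subst; module ≡-Reasoning)

-- Laurent polynomials acting on coefficient functions

infixl 6 _⊖_
_⊖_ : ∀ {ρ} → Vec ℤ ρ → Vec ℤ ρ → Vec ℤ ρ
_⊖_ = zipWith _-_

⊖-swap : ∀ {ρ} (r v w : Vec ℤ ρ) → r ⊖ v ⊖ w ≡ r ⊖ w ⊖ v
⊖-swap [] [] [] = refl
⊖-swap (x ∷ r) (y ∷ v) (z ∷ w) = cong₂ _∷_ (swap x y z) (⊖-swap r v w)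
  where
  swap : ∀ x y z → x - y - z ≡ x - z - y
  swap = solve-∀

infixl 6 _⊕_
infixl 7 _⊗_

-- The group ring of ℤ^ρ, i.e. Laurent polynomials in ρ variables.
data Laurent (ρ : ℕ) : Set where
  con     : ℤ → Laurent ρ
  mon     : Vec ℤ ρ → Laurent ρ
  _⊕_ _⊗_ : Laurent ρ → Laurent ρ → Laurent ρ

-- Multiplication of a formal series, given by its coefficient function, by a Laurent polynomial.
act : ∀ {ρ} → Laurent ρ → (Vec ℤ ρ → ℤ) → Vec ℤ ρ → ℤ
act (con c) g r = c * g r
act (mon v) g r = g (r ⊖ v)
act (f ⊕ h) g r = act f g r + act h g r
act (f ⊗ h) g   = act f (act h g)

act-cong : ∀ {ρ} (f : Laurent ρ) {g h} → (∀ r → g r ≡ h r) → ∀ r → act f g r ≡ act f h r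
act-cong (con c) g≗h r = cong (c *_) (g≗h r)
act-cong (mon v) g≗h r = g≗h (r ⊖ v)
act-cong (f₁ ⊕ f₂) g≗h r = cong₂ _+_ (act-cong f₁ g≗h r) (act-cong f₂ g≗h r)
act-cong (f₁ ⊗ f₂) g≗h r = act-cong f₁ (act-cong f₂ g≗h) r

act-+ : ∀ {ρ} (f : Laurent ρ) g h r → act f (λ s → g s + h s) r ≡ act f g r + act f h r
act-+ (con c) g h r = ℤₚ.*-distribˡ-+ c (g r) (h r)
act-+ (mon v) g h r = refl
act-+ (f₁ ⊕ f₂) g h r = trans (cong₂ _+_ (act-+ f₁ g h r) (act-+ f₂ g h r)) (lem (act f₁ g r) _ _ _)
  where
  lem : ∀ a b c d → (a + b) + (c + d) ≡ (a + c) + (b + d)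
  lem = solve-∀
act-+ (f₁ ⊗ f₂) g h r = trans (act-cong f₁ (act-+ f₂ g h) r) (act-+ f₁ (act f₂ g) (act f₂ h) r)

act-* : ∀ {ρ} (f : Laurent ρ) c g r → act f (λ s → c * g s) r ≡ c * act f g r
act-* (con d) c g r = lem d c (g r)
  where
  lem : ∀ d c x → d * (c * x) ≡ c * (d * x)
  lem = solve-∀
act-* (mon v) c g r = refl
act-* (f₁ ⊕ f₂) c g r =
  trans (cong₂ _+_ (act-* f₁ c g r) (act-* f₂ c g r)) (sym (ℤₚ.*-distribˡ-+ c _ _))
act-* (f₁ ⊗ f₂) c g r = trans (act-cong f₁ (act-* f₂ c g) r) (act-* f₁ c (act f₂ g) r)

act-shift : ∀ {ρ} (f : Laurent ρ) v g r → act f (λ s → g (s ⊖ v)) r ≡ act f g (r ⊖ v)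
act-shift (con c) v g r = refl
act-shift (mon w) v g r = cong g (⊖-swap r w v)
act-shift (f₁ ⊕ f₂) v g r = cong₂ _+_ (act-shift f₁ v g r) (act-shift f₂ v g r)
act-shift (f₁ ⊗ f₂) v g r = trans (act-cong f₁ (act-shift f₂ v g) r) (act-shift f₁ v (act f₂ g) r)

-- Constants and monomials generate `Laurent`, and they act by scalars and translations, with which
-- every action commutes by `act-*` and `act-shift`.
act-comm : ∀ {ρ} (f h : Laurent ρ) g r → act f (act h g) r ≡ act h (act f g) r
act-comm (con c) h g r = sym (act-* h c g r)
act-comm (mon v) h g r = sym (act-shift h v g r)
act-comm (f₁ ⊕ f₂) h g r =
  trans (cong₂ _+_ (act-comm f₁ h g r) (act-comm f₂ h g r)) (sym (act-+ h (act f₁ g) (act f₂ g) r))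
act-comm (f₁ ⊗ f₂) h g r =
  trans (act-cong f₁ (act-comm f₂ h g) r) (act-comm f₁ h (act f₂ g) r)

infix 4 _≈_
-- Two expressions are identified when they act alike on all coefficient functions, so no normal
-- form of Laurent polynomials is needed. Associativity of the product then holds by computation.
-- The record keeps `f` and `h` recoverable from the type.
record _≈_ {ρ} (f h : Laurent ρ) : Set where
  constructor equal
  field at : ∀ g r → act f g r ≡ act h g r
open _≈_ public

Laurent-commutativeRing : ℕ → CommutativeRing 0ℓ 0ℓ
Laurent-commutativeRing ρ = record
  { Carrier = Laurent ρ
  ; _≈_ = _≈_
  ; _+_ = _⊕_
  ; _*_ = _⊗_
  ; -_ = λ f → con (- (+ 1)) ⊗ f
  ; 0# = con (+ 0)
  ; 1# = con (+ 1)
  ; isCommutativeRing = record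
    { isRing = record
      { +-isAbelianGroup = record
        { isGroup = record
          { isMonoid = record
            { isSemigroup = record
              { isMagma = record
                { isEquivalence = record
                  { refl  = equal λ g r → refl
                  ; sym   = λ p → equal λ g r → sym (at p g r)
                  ; trans = λ p q → equal λ g r → trans (at p g r) (at q g r)
                  }
                ; ∙-cong = λ p q → equal λ g r → cong₂ _+_ (at p g r) (at q g r)
                }
              ; assoc = λ f h k → equal λ g r → ℤₚ.+-assoc (act f g r) (act h g r) (act k g r)
              }
            ; identity = (λ f → equal λ g r → ℤₚ.+-identityˡ _) , (λ f → equal λ g r → ℤₚ.+-identityʳ _)
            }
          ; inverse = (λ f → equal λ g r → invˡ (act f g r)) , (λ f → equal λ g r → invʳ (act f g r))
          ; ⁻¹-cong = λ p → equal λ g r → cong (- (+ 1) *_) (at p g r)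
          }
        ; comm = λ f h → equal λ g r → ℤₚ.+-comm (act f g r) (act h g r)
        }
      ; *-cong = λ {f} {f'} {h} {h'} p q → equal λ g r → trans (act-cong f (at q g) r) (at p (act h' g) r)
      ; *-assoc = λ f h k → equal λ g r → refl
      ; *-identity = (λ f → equal λ g r → ℤₚ.*-identityˡ _)
                   , (λ f → equal λ g r → trans (act-cong f (λ s → ℤₚ.*-identityˡ (g s)) r) refl)
      ; distrib = (λ f h k → equal λ g r → act-+ f (act h g) (act k g) r) , (λ f h k → equal λ g r → refl)
      }
    ; *-comm = λ f h → equal λ g r → act-comm f h g r
    }
  }
  where
  invˡ : ∀ x → - (+ 1) * x + x ≡ + 0 * x
  invˡ = solve-∀
  invʳ : ∀ x → x + - (+ 1) * x ≡ + 0 * x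
  invʳ = solve-∀

module _ {ρ : ℕ} where
  open CommutativeRing (Laurent-commutativeRing ρ) public
    using ( setoid; semiring; commutativeSemiring; +-cong; +-congˡ; +-congʳ; +-identityʳ; *-cong; *-congˡ; *-congʳ
          ; *-identityˡ; *-identityʳ; distribˡ; zeroˡ; zeroʳ )
    renaming (refl to ≈-refl; sym to ≈-sym; trans to ≈-trans)
  open Elementary (Laurent-commutativeRing ρ) public
  open import Algebra.Properties.Semiring.Sum semiring public
    using () renaming (sum to ⨁; sum-cong-≋ to ⨁-cong; *-distribˡ-sum to ⊗-distribˡ-⨁)
  open import Algebra.Properties.Semiring.Exp semiring public using (_^_; ^-homo-*)

-- Vector fields and derivatives of Laurent polynomials

ray : ∀ {ρ} → Fin ρ → ℤ → Vec ℤ ρ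
ray zero    k = k ∷ replicate _ (+ 0)
ray (suc i) k = + 0 ∷ ray i k

sum-zero : ∀ n (h : Fin n → ℤ) → (∀ i → h i ≡ + 0) → sum h ≡ + 0
sum-zero n h z = trans (sum-cong-≗ z) (sum-replicate-zero n)

sum-ray : ∀ {ρ} (j : Fin ρ) h → sum (λ i → lookup (ray j (+ 1)) i * h i) ≡ h j
sum-ray {suc ρ} zero h = begin
  + 1 * h zero + sum (λ i → lookup (replicate ρ (+ 0)) i * h (suc i))
    ≡⟨ cong₂ _+_ (ℤₚ.*-identityˡ (h zero))
         (sum-zero ρ _ λ i → cong (_* h (suc i)) (Vecₚ.lookup-replicate i (+ 0))) ⟩
  h zero + + 0
    ≡⟨ ℤₚ.+-identityʳ (h zero) ⟩
  h zero ∎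
  where open ≡-Reasoning
sum-ray (suc j) h = trans (ℤₚ.+-identityˡ _) (sum-ray j (λ i → h (suc i)))

⊖-identityʳ : ∀ {ρ} (r : Vec ℤ ρ) → r ⊖ replicate ρ (+ 0) ≡ r
⊖-identityʳ = Vecₚ.zipWith-identityʳ ℤₚ.+-identityʳ

⊖-ray : ∀ {ρ} (r : Vec ℤ ρ) j k l → r ⊖ ray j k ⊖ ray j l ≡ r ⊖ ray j (k + l)
⊖-ray (x ∷ r) zero k l = cong₂ _∷_ (lem x k l) (⊖-identityʳ _)
  where
  lem : ∀ x k l → x - k - l ≡ x - (k + l)
  lem = solve-∀
⊖-ray (x ∷ r) (suc j) k l = cong₂ _∷_ (ℤₚ.+-identityʳ (x - + 0)) (⊖-ray r j k l)

mon-ray : ∀ {ρ} (j : Fin ρ) k l → mon (ray j k) ⊗ mon (ray j l) ≈ mon (ray j (k + l))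
mon-ray j k l = equal λ g r → cong g (⊖-ray r j k l)

-- On coefficient functions, Q k is the vector field Σᵢ xᵢᵏ⁺¹ ∂ᵢ.
Q : ∀ {ρ} → ℤ → (Vec ℤ ρ → ℤ) → Vec ℤ ρ → ℤ
Q k g r = sum (λ i → (lookup r i - k) * g (r ⊖ ray i k))

-- The derivative is characterised as a commutator of operators, [Q k, f] = f′. In this form the
-- product rule is a formal computation, and `f′` may be replaced by anything equivalent to it.
record Derivative {ρ} (k : ℤ) (f f′ : Laurent ρ) : Set where
  constructor derivative
  field commutator : ∀ g r → Q k (act f g) r ≡ act f (Q k g) r + act f′ g r
open Derivative public

module _ {ρ : ℕ} {k : ℤ} where

  derivative-resp : ∀ {f : Laurent ρ} {f′ f″} → f′ ≈ f″ → Derivative k f f′ → Derivative k f f″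
  derivative-resp {f = f} eq d = derivative λ g r →
    trans (commutator d g r) (cong (λ z → act f (Q k g) r + z) (at eq g r))

  derivative-con : ∀ c → Derivative {ρ} k (con c) (con (+ 0))
  derivative-con c = derivative λ g r → begin
    sum (λ i → (lookup r i - k) * (c * g (r ⊖ ray i k)))
      ≡⟨ sum-cong-≗ (λ i → lem (lookup r i - k) c (g (r ⊖ ray i k))) ⟩
    sum (λ i → c * ((lookup r i - k) * g (r ⊖ ray i k)))
      ≡⟨ *-distribˡ-sum c (λ i → (lookup r i - k) * g (r ⊖ ray i k)) ⟨
    c * Q k g r
      ≡⟨ ℤₚ.+-identityʳ _ ⟨
    c * Q k g r + + 0 ∎
    where
    open ≡-Reasoning
    lem : ∀ a c x → a * (c * x) ≡ c * (a * x)
    lem = solve-∀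

  derivative-mon : ∀ j → Derivative {ρ} k (mon (ray j (+ 1))) (mon (ray j (+ 1 + k)))
  derivative-mon j = derivative λ g r → begin
    sum (λ i → (lookup r i - k) * g (r ⊖ ray i k ⊖ v))
      -- Writing rᵢ = (rᵢ - vᵢ) + vᵢ separates the vector field applied to the shifted function from
      -- the commutator, in which only i = j survives.
      ≡⟨ sum-cong-≗ (split g r) ⟩
    sum (λ i → (lookup (r ⊖ v) i - k) * g (r ⊖ v ⊖ ray i k) + lookup v i * g (r ⊖ v ⊖ ray i k))
      ≡⟨ ∑-distrib-+ (λ i → (lookup (r ⊖ v) i - k) * g (r ⊖ v ⊖ ray i k)) _ ⟩
    Q k g (r ⊖ v) + sum (λ i → lookup v i * g (r ⊖ v ⊖ ray i k))
      ≡⟨ cong (λ z → Q k g (r ⊖ v) + z) (sum-ray j _) ⟩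
    Q k g (r ⊖ v) + g (r ⊖ v ⊖ ray j k)
      ≡⟨ cong (λ w → Q k g (r ⊖ v) + g w) (⊖-ray r j (+ 1) k) ⟩
    Q k g (r ⊖ v) + g (r ⊖ ray j (+ 1 + k)) ∎
    where
    open ≡-Reasoning
    v = ray j (+ 1)
    lem : ∀ a b k x → (a - k) * x ≡ ((a - b) - k) * x + b * x
    lem = solve-∀
    split : ∀ (g : Vec ℤ ρ → ℤ) r i → (lookup r i - k) * g (r ⊖ ray i k ⊖ v)
                ≡ (lookup (r ⊖ v) i - k) * g (r ⊖ v ⊖ ray i k) + lookup v i * g (r ⊖ v ⊖ ray i k)
    split g r i rewrite ⊖-swap r (ray i k) v | Vecₚ.lookup-zipWith _-_ i r v =
      lem (lookup r i) (lookup v i) k _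

  derivative-⊕ : ∀ {f f′ h h′ : Laurent ρ} → Derivative k f f′ → Derivative k h h′ →
                 Derivative k (f ⊕ h) (f′ ⊕ h′)
  derivative-⊕ {f} {f′} {h} {h′} df dh = derivative λ g r → begin
    sum (λ i → (lookup r i - k) * (act f g (r ⊖ ray i k) + act h g (r ⊖ ray i k)))
      ≡⟨ sum-cong-≗ (λ i → ℤₚ.*-distribˡ-+ (lookup r i - k) _ _) ⟩
    sum (λ i → (lookup r i - k) * act f g (r ⊖ ray i k) + (lookup r i - k) * act h g (r ⊖ ray i k))
      ≡⟨ ∑-distrib-+ (λ i → (lookup r i - k) * act f g (r ⊖ ray i k)) _ ⟩
    Q k (act f g) r + Q k (act h g) r
      ≡⟨ cong₂ _+_ (commutator df g r) (commutator dh g r) ⟩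
    (act f (Q k g) r + act f′ g r) + (act h (Q k g) r + act h′ g r)
      ≡⟨ lem (act f (Q k g) r) _ _ _ ⟩
    (act f (Q k g) r + act h (Q k g) r) + (act f′ g r + act h′ g r) ∎
    where
    open ≡-Reasoning
    lem : ∀ a b c d → (a + b) + (c + d) ≡ (a + c) + (b + d)
    lem = solve-∀

  derivative-⊗ : ∀ {f f′ h h′ : Laurent ρ} → Derivative k f f′ → Derivative k h h′ →
                 Derivative k (f ⊗ h) (f′ ⊗ h ⊕ f ⊗ h′)
  derivative-⊗ {f} {f′} {h} {h′} df dh = derivative λ g r → begin
    Q k (act f (act h g)) r
      ≡⟨ commutator df (act h g) r ⟩
    act f (Q k (act h g)) r + act f′ (act h g) r
      ≡⟨ cong (_+ act f′ (act h g) r) (act-cong f (commutator dh g) r) ⟩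
    act f (λ s → act h (Q k g) s + act h′ g s) r + act f′ (act h g) r
      ≡⟨ cong (_+ act f′ (act h g) r) (act-+ f _ _ r) ⟩
    (act f (act h (Q k g)) r + act f (act h′ g) r) + act f′ (act h g) r
      ≡⟨ lem (act f (act h (Q k g)) r) _ _ ⟩
    act f (act h (Q k g)) r + (act f′ (act h g) r + act f (act h′ g) r) ∎
    where
    open ≡-Reasoning
    lem : ∀ a b c → (a + b) + c ≡ a + (c + b)
    lem = solve-∀

  derivative-e : ∀ {v : Laurent ρ → Laurent ρ} {xs} → Pointwise (λ x y → Derivative k x (v y)) xs xs →
                 ∀ j → Derivative k (e xs j) (∂e v xs j)
  derivative-e []        zero    = derivative-con (+ 1)
  derivative-e (_ ∷ _)   zero    = derivative-con (+ 1)
  derivative-e []        (suc j) = derivative-con (+ 0)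
  derivative-e {v} {x ∷ xs} (dx ∷ dxs) (suc j) =
    derivative-⊕ {f = e xs (suc j)} {h = x ⊗ e xs j} (derivative-e dxs (suc j))
      (derivative-⊗ {f = x} {h = e xs j} dx (derivative-e dxs j))

_≟ⱽ_ : ∀ {ρ} (r s : Vec ℤ ρ) → Dec (r ≡ s)
_≟ⱽ_ = Vecₚ.≡-dec ℤₚ._≟_

indicator : ∀ {P : Set} → Dec P → ℤ
indicator (yes _) = + 1
indicator (no  _) = + 0

-- The coefficient function of the constant 1, so that `act f δ` is the coefficient function of `f`.
δ : ∀ {ρ} → Vec ℤ ρ → ℤ
δ {ρ} r = indicator (r ≟ⱽ replicate ρ (+ 0))

lookup-ray : ∀ {ρ} (i : Fin ρ) k → lookup (ray i k) i ≡ k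
lookup-ray zero    k = refl
lookup-ray (suc i) k = lookup-ray i k

-- The vector field kills constants: the i-th value of `δ` is nonzero only if rᵢ = k, and there the
-- factor rᵢ - k vanishes.
Q-δ : ∀ {ρ} k (r : Vec ℤ ρ) → Q k δ r ≡ + 0
Q-δ {ρ} k r = sum-zero ρ _ term
  where
  term : ∀ i → (lookup r i - k) * δ (r ⊖ ray i k) ≡ + 0
  term i with (r ⊖ ray i k) ≟ⱽ replicate ρ (+ 0)
  ... | no _   = ℤₚ.*-zeroʳ (lookup r i - k)
  ... | yes eq = cong (_* + 1) (begin
    lookup r i - k                   ≡⟨ cong (λ z → lookup r i - z) (lookup-ray i k) ⟨
    lookup r i - lookup (ray i k) i  ≡⟨ Vecₚ.lookup-zipWith _-_ i r (ray i k) ⟨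
    lookup (r ⊖ ray i k) i           ≡⟨ cong (λ v → lookup v i) eq ⟩
    lookup (replicate ρ (+ 0)) i     ≡⟨ Vecₚ.lookup-replicate i (+ 0) ⟩
    + 0                              ∎)
    where open ≡-Reasoning

act-0 : ∀ {ρ} (f : Laurent ρ) {g} → (∀ r → g r ≡ + 0) → ∀ r → act f g r ≡ + 0
act-0 f {g} z r = trans (act-cong f z r) (act-* f (+ 0) (λ _ → + 0) r)

-- The coefficient of (x₁⋯xᵨ)ᵐ.
coeff : ∀ {ρ} → ℤ → Laurent ρ → ℤ
coeff m f = act f δ (replicate _ m)

-- Apply the commutator to `δ`, which `Q k` annihilates. The coordinates of (m, ..., m) all equal m,
-- so m - k leaves the sum and what remains is the coefficient of a power sum times `f`. At an
-- exponent vector with unequal coordinates the factors would differ.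
derivative-coeff : ∀ {ρ} k m (f : Laurent ρ) {f′} → Derivative k f f′ →
                   (m - k) * sum (λ i → coeff m (mon (ray {ρ} i k) ⊗ f)) ≡ coeff m f′
derivative-coeff {ρ} k m f {f′} df = begin
  (m - k) * sum (λ i → act f δ (mv ⊖ ray i k))
    ≡⟨ *-distribˡ-sum (m - k) (λ i → act f δ (mv ⊖ ray i k)) ⟩
  sum (λ i → (m - k) * act f δ (mv ⊖ ray i k))
    ≡⟨ sum-cong-≗ (λ i → cong (λ z → (z - k) * act f δ (mv ⊖ ray i k)) (Vecₚ.lookup-replicate i m)) ⟨
  Q k (act f δ) mv
    ≡⟨ commutator df δ mv ⟩
  act f (Q k δ) mv + coeff m f′
    ≡⟨ cong (_+ coeff m f′) (act-0 f (Q-δ k) mv) ⟩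
  + 0 + coeff m f′
    ≡⟨ ℤₚ.+-identityˡ _ ⟩
  coeff m f′ ∎
  where
  open ≡-Reasoning
  mv = replicate ρ m

-- Monomials in given Laurent polynomials and their derivatives

lower : ∀ {n} → Fin n → Vec ℕ n → Vec ℕ n
lower zero    (a ∷ α) = (a ∸ 1) ∷ α
lower (suc i) (a ∷ α) = a ∷ lower i α

unit : ∀ {n} → Fin n → Vec ℕ n
unit zero    = 1 ∷ replicate _ 0
unit (suc i) = 0 ∷ unit i

module _ {ρ : ℕ} where
  open import Algebra.Solver.Ring.NaturalCoefficients.Default (commutativeSemiring {ρ})
    using (solve; _:=_; _:+_; _:*_) renaming (con to :con)
  open import Relation.Binary.Reasoning.Setoid (setoid {ρ})

  mono : ∀ {n} → Vec (Laurent ρ) n → Vec ℕ n → Laurent ρ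
  mono []       []      = con (+ 1)
  mono (x ∷ xs) (a ∷ α) = x ^ a ⊗ mono xs α

  con-suc : ∀ n → con {ρ} (+ suc n) ≈ con (+ 1) ⊕ con (+ n)
  con-suc n = equal λ g r → ℤₚ.*-distribʳ-+ (g r) (+ 1) (+ n)

  -- The truncated exponent `n ∸ 1` is harmless at n = 0, where the factor n vanishes. The same
  -- applies to every later use of `lower`.
  derivative-^ : ∀ {k} {x x′ : Laurent ρ} → Derivative k x x′ →
                 ∀ n → Derivative k (x ^ n) (con (+ n) ⊗ (x ^ (n ∸ 1) ⊗ x′))
  derivative-^ dx zero = derivative-resp (≈-sym (zeroˡ _)) (derivative-con (+ 1))
  derivative-^ {x = x} {x′} dx (suc zero) =
    derivative-resp
      (solve 2 (λ x x′ → x′ :* :con 1 :+ x :* (:con 0 :* (:con 1 :* x′)) := :con 1 :* (:con 1 :* x′)) ≈-refl x x′)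
      (derivative-⊗ {f = x} {h = x ^ 0} dx (derivative-^ dx 0))
  derivative-^ {x = x} {x′} dx (suc (suc n)) =
    derivative-resp eq (derivative-⊗ {f = x} {h = x ^ suc n} dx (derivative-^ dx (suc n)))
    where
    eq : x′ ⊗ (x ⊗ x ^ n) ⊕ x ⊗ (con (+ suc n) ⊗ (x ^ n ⊗ x′)) ≈ con (+ suc (suc n)) ⊗ ((x ⊗ x ^ n) ⊗ x′)
    eq = begin
      x′ ⊗ (x ⊗ x ^ n) ⊕ x ⊗ (con (+ suc n) ⊗ (x ^ n ⊗ x′))
        ≈⟨ solve 4 (λ x x′ y c → x′ :* (x :* y) :+ x :* (c :* (y :* x′)) := (:con 1 :+ c) :* ((x :* y) :* x′))
             ≈-refl x x′ (x ^ n) (con (+ suc n)) ⟩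
      (con (+ 1) ⊕ con (+ suc n)) ⊗ ((x ⊗ x ^ n) ⊗ x′)
        ≈⟨ *-congʳ (con-suc (suc n)) ⟨
      con (+ suc (suc n)) ⊗ ((x ⊗ x ^ n) ⊗ x′) ∎

  derivative-mono : ∀ {k n} (xs : Vec (Laurent ρ) n) (x′ : Fin n → Laurent ρ) →
                    (∀ i → Derivative k (lookup xs i) (x′ i)) →
                    ∀ α → Derivative k (mono xs α) (⨁ λ i → con (+ lookup α i) ⊗ (mono xs (lower i α) ⊗ x′ i))
  derivative-mono [] x′ dx [] = derivative-con (+ 1)
  derivative-mono (x ∷ xs) x′ dx (a ∷ α) =
    derivative-resp eq
      (derivative-⊗ {f = x ^ a} {h = mono xs α} (derivative-^ (dx zero) a)
        (derivative-mono xs (x′ ∘ suc) (dx ∘ suc) α))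
    where
    eq : (con (+ a) ⊗ (x ^ (a ∸ 1) ⊗ x′ zero)) ⊗ mono xs α
           ⊕ x ^ a ⊗ (⨁ λ i → con (+ lookup α i) ⊗ (mono xs (lower i α) ⊗ x′ (suc i)))
         ≈ con (+ a) ⊗ ((x ^ (a ∸ 1) ⊗ mono xs α) ⊗ x′ zero)
           ⊕ ⨁ λ i → con (+ lookup α i) ⊗ ((x ^ a ⊗ mono xs (lower i α)) ⊗ x′ (suc i))
    eq = +-cong
      (solve 4 (λ c y x′ z → (c :* (y :* x′)) :* z := c :* ((y :* z) :* x′)) ≈-refl
        (con (+ a)) (x ^ (a ∸ 1)) (x′ zero) (mono xs α))
      (≈-trans
        (⊗-distribˡ-⨁ (x ^ a) (λ i → con (+ lookup α i) ⊗ (mono xs (lower i α) ⊗ x′ (suc i))))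
        (⨁-cong {x = λ i → x ^ a ⊗ (con (+ lookup α i) ⊗ (mono xs (lower i α) ⊗ x′ (suc i)))}
          {y = λ i → con (+ lookup α i) ⊗ ((x ^ a ⊗ mono xs (lower i α)) ⊗ x′ (suc i))}
          λ i → solve 4 (λ y c z x′ → y :* (c :* (z :* x′)) := c :* ((y :* z) :* x′)) ≈-refl
                  (x ^ a) (con (+ lookup α i)) (mono xs (lower i α)) (x′ (suc i))))

  mono-+ : ∀ {n} (xs : Vec (Laurent ρ) n) α β → mono xs (zipWith _+ℕ_ α β) ≈ mono xs α ⊗ mono xs β
  mono-+ [] [] [] = ≈-sym (*-identityˡ _)
  mono-+ (x ∷ xs) (a ∷ α) (b ∷ β) = begin
    x ^ (a +ℕ b) ⊗ mono xs (zipWith _+ℕ_ α β)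
      ≈⟨ *-cong (^-homo-* x a b) (mono-+ xs α β) ⟩
    (x ^ a ⊗ x ^ b) ⊗ (mono xs α ⊗ mono xs β)
      ≈⟨ solve 4 (λ a b c d → (a :* b) :* (c :* d) := (a :* c) :* (b :* d)) ≈-refl _ _ _ _ ⟩
    (x ^ a ⊗ mono xs α) ⊗ (x ^ b ⊗ mono xs β) ∎

  mono-0 : ∀ {n} (xs : Vec (Laurent ρ) n) → mono xs (replicate n 0) ≈ con (+ 1)
  mono-0 []       = ≈-refl
  mono-0 (x ∷ xs) = ≈-trans (*-identityˡ _) (mono-0 xs)

  mono-unit : ∀ {n} (xs : Vec (Laurent ρ) n) i → mono xs (unit i) ≈ lookup xs i
  mono-unit (x ∷ xs) zero    = ≈-trans (*-cong (*-identityʳ x) (mono-0 xs)) (*-identityʳ x)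
  mono-unit (x ∷ xs) (suc i) = ≈-trans (*-identityˡ _) (mono-unit xs i)

-- Polynomials as computable lists of terms

Terms : ℕ → Set
Terms n = List (ℤ × Vec ℕ n)

infixl 6 _·ᵗ_
infixr 7 _∙ᵗ_
_∙ᵗ_ : ∀ {n} → ℤ × Vec ℕ n → Terms n → Terms n
(c , α) ∙ᵗ ts = List.map (λ { (d , β) → c * d , zipWith _+ℕ_ α β }) ts

_·ᵗ_ : ∀ {n} → Terms n → Terms n → Terms n
[]       ·ᵗ us = []
(t ∷ ts) ·ᵗ us = t ∙ᵗ us ++ ts ·ᵗ us

scaleᵗ : ∀ {n} → ℤ → Terms n → Terms n
scaleᵗ c ts = (c , replicate _ 0) ∙ᵗ ts

module _ {ρ n : ℕ} (xs : Vec (Laurent ρ) n) where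
  open import Algebra.Solver.Ring.NaturalCoefficients.Default (commutativeSemiring {ρ})
    using (solve; _:=_; _:+_; _:*_) renaming (con to :con)
  open import Relation.Binary.Reasoning.Setoid (setoid {ρ})

  poly : Terms n → Laurent ρ
  poly []             = con (+ 0)
  poly ((c , α) ∷ ts) = con c ⊗ mono xs α ⊕ poly ts

  poly-++ : ∀ ts us → poly (ts ++ us) ≈ poly ts ⊕ poly us
  poly-++ []             us = ≈-sym (equal λ g r → ℤₚ.+-identityˡ _)
  poly-++ ((c , α) ∷ ts) us = begin
    con c ⊗ mono xs α ⊕ poly (ts ++ us)
      ≈⟨ +-congˡ (poly-++ ts us) ⟩
    con c ⊗ mono xs α ⊕ (poly ts ⊕ poly us)
      ≈⟨ solve 3 (λ a b c → a :+ (b :+ c) := (a :+ b) :+ c) ≈-refl _ _ _ ⟩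
    con c ⊗ mono xs α ⊕ poly ts ⊕ poly us ∎

  poly-∙ᵗ : ∀ c α us → poly ((c , α) ∙ᵗ us) ≈ (con c ⊗ mono xs α) ⊗ poly us
  poly-∙ᵗ c α []             = ≈-sym (zeroʳ _)
  poly-∙ᵗ c α ((d , β) ∷ us) = begin
    con (c * d) ⊗ mono xs (zipWith _+ℕ_ α β) ⊕ poly ((c , α) ∙ᵗ us)
      ≈⟨ +-cong (*-cong (equal λ g r → ℤₚ.*-assoc c d (g r)) (mono-+ xs α β)) (poly-∙ᵗ c α us) ⟩
    (con c ⊗ con d) ⊗ (mono xs α ⊗ mono xs β) ⊕ (con c ⊗ mono xs α) ⊗ poly us
      ≈⟨ solve 5 (λ c d a b u → (c :* d) :* (a :* b) :+ (c :* a) :* u := (c :* a) :* (d :* b :+ u)) ≈-refl _ _ _ _ _ ⟩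
    (con c ⊗ mono xs α) ⊗ (con d ⊗ mono xs β ⊕ poly us) ∎

  poly-·ᵗ : ∀ ts us → poly (ts ·ᵗ us) ≈ poly ts ⊗ poly us
  poly-·ᵗ []             us = ≈-sym (zeroˡ _)
  poly-·ᵗ ((c , α) ∷ ts) us = begin
    poly ((c , α) ∙ᵗ us ++ ts ·ᵗ us)
      ≈⟨ poly-++ ((c , α) ∙ᵗ us) (ts ·ᵗ us) ⟩
    poly ((c , α) ∙ᵗ us) ⊕ poly (ts ·ᵗ us)
      ≈⟨ +-cong (poly-∙ᵗ c α us) (poly-·ᵗ ts us) ⟩
    (con c ⊗ mono xs α) ⊗ poly us ⊕ poly ts ⊗ poly us
      ≈⟨ solve 3 (λ a b u → a :* u :+ b :* u := (a :+ b) :* u) ≈-refl _ _ _ ⟩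
    (con c ⊗ mono xs α ⊕ poly ts) ⊗ poly us ∎

  poly-scaleᵗ : ∀ c us → poly (scaleᵗ c us) ≈ con c ⊗ poly us
  poly-scaleᵗ c us =
    ≈-trans (poly-∙ᵗ c (replicate n 0) us) (*-congʳ (≈-trans (*-congˡ (mono-0 xs)) (*-identityʳ _)))

-- The linear extension to polynomials of a function on monomials. Repeated monomials in the list
-- are allowed and simply add up.
evalᵗ : ∀ {n} → (Vec ℕ n → ℤ) → Terms n → ℤ
evalᵗ V []             = + 0
evalᵗ V ((c , β) ∷ ts) = c * V β + evalᵗ V ts

module _ {ρ : ℕ} where

  coeff-cong : ∀ m {f h : Laurent ρ} → f ≈ h → coeff m f ≡ coeff m h
  coeff-cong m eq = at eq δ _

  coeff-⨁ : ∀ m {n} (f : Fin n → Laurent ρ) → coeff m (⨁ f) ≡ sum (λ i → coeff m (f i))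
  coeff-⨁ m {zero}  f = refl
  coeff-⨁ m {suc n} f = cong (λ z → coeff m (f zero) + z) (coeff-⨁ m (f ∘ suc))

  coeff-poly : ∀ m {n} (xs : Vec (Laurent ρ) n) α ts →
               coeff m (mono xs α ⊗ poly xs ts) ≡ evalᵗ (λ β → coeff m (mono xs (zipWith _+ℕ_ α β))) ts
  coeff-poly m xs α []             = act-0 (mono xs α) (λ _ → refl) _
  coeff-poly m xs α ((c , β) ∷ ts) =
    trans (coeff-cong m {mono xs α ⊗ (con c ⊗ mono xs β ⊕ poly xs ts)}
             {con c ⊗ mono xs (zipWith _+ℕ_ α β) ⊕ mono xs α ⊗ poly xs ts}
             (≈-trans (distribˡ (mono xs α) (con c ⊗ mono xs β) (poly xs ts)) (+-congʳ (≈-trans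
               (solve 3 (λ a c b → a :* (c :* b) := c :* (a :* b)) ≈-refl (mono xs α) (con c) (mono xs β))
               (*-congˡ {ρ} {con c} (≈-sym (mono-+ xs α β)))))))
          (cong (λ z → coeff m (con c ⊗ mono xs (zipWith _+ℕ_ α β)) + z) (coeff-poly m xs α ts))
    where
    open import Algebra.Solver.Ring.NaturalCoefficients.Default (commutativeSemiring {ρ})
      using (solve; _:=_; _:*_)

-- The vector fields of order 1 and 2 in terms of the eⱼ

module _ {ρ : ℕ} where

  vars : List (Laurent ρ)
  vars = List.tabulate (λ i → mon (ray i (+ 1)))

  elems : Vec (Laurent ρ) ρ
  elems = tabulate (λ i → e vars (suc (toℕ i)))

  -- The constant 1 at index 0 and the zero polynomial above ρ let `D₁` and `D₂` be uniform in j,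
  -- although they reach up to eⱼ₊₁ and eⱼ₊₂.
  E : ℕ → Terms ρ
  E zero    = (+ 1 , replicate _ 0) ∷ []
  E (suc i) with i ℕ.<? ρ
  ... | yes i<ρ = (+ 1 , unit (fromℕ< i<ρ)) ∷ []
  ... | no  _   = []

  P₁ P₂ : Terms ρ
  P₁ = E 1
  P₂ = E 1 ·ᵗ E 1 ++ scaleᵗ (- (+ 2)) (E 2)

  D₁ D₂ : ℕ → Terms ρ
  D₁ j = P₁ ·ᵗ E j ++ scaleᵗ (- (+ suc j)) (E (suc j))
  D₂ j = (P₂ ·ᵗ E j ++ scaleᵗ (+ suc (suc j)) (E (suc (suc j)))) ++ scaleᵗ (- (+ 1)) (P₁ ·ᵗ E (suc j))

  open import Relation.Binary.Reasoning.Setoid (setoid {ρ})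

  poly-monomial : ∀ {n} (xs : Vec (Laurent ρ) n) {α f} → mono xs α ≈ f → poly xs ((+ 1 , α) ∷ []) ≈ f
  poly-monomial xs eq = ≈-trans (+-identityʳ _) (≈-trans (*-identityˡ _) eq)

  poly-E : ∀ j → poly elems (E j) ≈ e vars j
  poly-E zero    = poly-monomial elems (mono-0 elems)
  poly-E (suc i) with i ℕ.<? ρ
  ... | yes i<ρ = poly-monomial elems (begin
    mono elems (unit (fromℕ< i<ρ))        ≈⟨ mono-unit elems (fromℕ< i<ρ) ⟩
    lookup elems (fromℕ< i<ρ)             ≡⟨ Vecₚ.lookup∘tabulate _ (fromℕ< i<ρ) ⟩
    e vars (suc (toℕ (fromℕ< i<ρ)))       ≡⟨ cong (e vars ∘ suc) (Finₚ.toℕ-fromℕ< i<ρ) ⟩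
    e vars (suc i)                        ∎)
  ... | no  i≮ρ = begin
    con (+ 0)
      ≈⟨ e-vanishes vars (i ∸ ρ) ⟨
    e vars (suc (List.length vars +ℕ (i ∸ ρ)))
      ≡⟨ cong (λ l → e vars (suc (l +ℕ (i ∸ ρ)))) (Listₚ.length-tabulate (λ i → mon {ρ} (ray i (+ 1)))) ⟩
    e vars (suc (ρ +ℕ (i ∸ ρ)))
      ≡⟨ cong (e vars ∘ suc) (ℕₚ.m+[n∸m]≡n (ℕₚ.≮⇒≥ i≮ρ)) ⟩
    e vars (suc i) ∎

  nat≈con : ∀ n → nat n ≈ con {ρ} (+ n)
  nat≈con zero    = ≈-refl
  nat≈con (suc n) = ≈-trans (+-congˡ (nat≈con n)) (≈-sym (con-suc n))

  isolate : ∀ c {f h k : Laurent ρ} → f ⊕ con c ⊗ h ≈ k → f ≈ k ⊕ con (- c) ⊗ h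
  isolate c {f} {h} {k} eq = equal λ g r → lem (act f g r) c (act h g r) (act k g r) (at eq g r)
    where
    lem′ : ∀ x c y → x ≡ (x + c * y) + - c * y
    lem′ = solve-∀
    lem : ∀ x c y z → x + c * y ≡ z → x ≡ z + - c * y
    lem x c y z p = trans (lem′ x c y) (cong (_+ - c * y) p)

  poly-P₁ : poly elems P₁ ≈ p₁ vars
  poly-P₁ = ≈-trans (poly-E 1) (e₁≈p₁ vars)

  poly-P₂ : poly elems P₂ ≈ p₂ vars
  poly-P₂ = begin
    poly elems (E 1 ·ᵗ E 1 ++ scaleᵗ (- (+ 2)) (E 2))
      ≈⟨ poly-++ elems (E 1 ·ᵗ E 1) _ ⟩
    poly elems (E 1 ·ᵗ E 1) ⊕ poly elems (scaleᵗ (- (+ 2)) (E 2))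
      ≈⟨ +-cong (≈-trans (poly-·ᵗ elems (E 1) (E 1)) (*-cong poly-P₁ poly-P₁))
                (≈-trans (poly-scaleᵗ elems (- (+ 2)) (E 2)) (*-congˡ (poly-E 2))) ⟩
    p₁ vars ⊗ p₁ vars ⊕ con (- (+ 2)) ⊗ e vars 2
      ≈⟨ isolate (+ 2) (≈-trans (+-congˡ (equal λ g r → lem (act (e vars 2) g r))) (p₂+2e₂ vars)) ⟨
    p₂ vars ∎
    where
    lem : ∀ x → + 2 * x ≡ x + x
    lem = solve-∀

  poly-D₁ : ∀ j → ∂e (λ x → x ⊗ x) vars j ≈ poly elems (D₁ j)
  poly-D₁ j = begin
    ∂e (λ x → x ⊗ x) vars j
      ≈⟨ isolate (+ suc j) (≈-trans (+-congˡ (*-congʳ (≈-sym (nat≈con (suc j))))) (∂₁e vars j)) ⟩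
    p₁ vars ⊗ e vars j ⊕ con (- (+ suc j)) ⊗ e vars (suc j)
      ≈⟨ +-cong (≈-trans (poly-·ᵗ elems P₁ (E j)) (*-cong poly-P₁ (poly-E j)))
                (≈-trans (poly-scaleᵗ elems (- (+ suc j)) (E (suc j))) (*-congˡ (poly-E (suc j)))) ⟨
    poly elems (P₁ ·ᵗ E j) ⊕ poly elems (scaleᵗ (- (+ suc j)) (E (suc j)))
      ≈⟨ poly-++ elems (P₁ ·ᵗ E j) _ ⟨
    poly elems (D₁ j) ∎

  poly-D₂ : ∀ j → ∂e (λ x → x ⊗ (x ⊗ x)) vars j ≈ poly elems (D₂ j)
  poly-D₂ j = begin
    ∂e (λ x → x ⊗ (x ⊗ x)) vars j
      ≈⟨ isolate (+ 1) (≈-trans (+-congˡ (*-identityˡ _)) (≈-trans (∂₂e vars j)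
           (+-congˡ (*-congʳ (nat≈con (suc (suc j))))))) ⟩
    (p₂ vars ⊗ e vars j ⊕ con (+ suc (suc j)) ⊗ e vars (suc (suc j)))
      ⊕ con (- (+ 1)) ⊗ (p₁ vars ⊗ e vars (suc j))
      ≈⟨ +-cong
           (≈-trans (poly-++ elems (P₂ ·ᵗ E j) _)
             (+-cong (≈-trans (poly-·ᵗ elems P₂ (E j)) (*-cong poly-P₂ (poly-E j)))
                     (≈-trans (poly-scaleᵗ elems (+ suc (suc j)) (E (suc (suc j)))) (*-congˡ (poly-E (suc (suc j)))))))
           (≈-trans (poly-scaleᵗ elems (- (+ 1)) (P₁ ·ᵗ E (suc j)))
             (*-congˡ (≈-trans (poly-·ᵗ elems P₁ (E (suc j))) (*-cong poly-P₁ (poly-E (suc j)))))) ⟨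
    poly elems (P₂ ·ᵗ E j ++ scaleᵗ (+ suc (suc j)) (E (suc (suc j))))
      ⊕ poly elems (scaleᵗ (- (+ 1)) (P₁ ·ᵗ E (suc j)))
      ≈⟨ poly-++ elems (P₂ ·ᵗ E j ++ scaleᵗ (+ suc (suc j)) (E (suc (suc j)))) _ ⟨
    poly elems (D₂ j) ∎

act-p₁ : ∀ {ρ n} (x : Fin n → Laurent ρ) g r → act (p₁ (List.tabulate x)) g r ≡ sum (λ i → act (x i) g r)
act-p₁ {n = zero}  x g r = refl
act-p₁ {n = suc n} x g r = cong (λ z → act (x zero) g r + z) (act-p₁ (x ∘ suc) g r)

act-p₂ : ∀ {ρ n} (x : Fin n → Laurent ρ) g r → act (p₂ (List.tabulate x)) g r ≡ sum (λ i → act (x i ⊗ x i) g r)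
act-p₂ {n = zero}  x g r = refl
act-p₂ {n = suc n} x g r = cong (λ z → act (x zero ⊗ x zero) g r + z) (act-p₂ (x ∘ suc) g r)

-- The vector field Σᵢ xᵢᵏ⁺¹ ∂ᵢ for k = order: its values image j at eⱼ and the power sum Σᵢ xᵢᵏ,
-- as polynomials in the eⱼ.
record VectorField (ρ : ℕ) : Set where
  field
    order : ℕ
    powerSum : Terms ρ
    image : ℕ → Terms ρ
    powerSum-sound : ∀ g r → sum (λ i → g (r ⊖ ray {ρ} i (+ order))) ≡ act (poly elems powerSum) g r
    image-sound : ∀ i → Derivative (+ order) (lookup elems i) (poly elems (image (suc (toℕ i))))

derivative-elems : ∀ {ρ k} (v : Laurent ρ → Laurent ρ) (D : ℕ → Terms ρ) →
                   (∀ j → Derivative k (mon (ray j (+ 1))) (v (mon (ray j (+ 1))))) →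
                   (∀ j → ∂e v vars j ≈ poly elems (D j)) →
                   ∀ i → Derivative k (lookup elems i) (poly elems (D (suc (toℕ i))))
derivative-elems v D dx eq i =
  subst (λ f → Derivative _ f (poly elems (D (suc (toℕ i))))) (sym (Vecₚ.lookup∘tabulate _ i))
    (derivative-resp (eq (suc (toℕ i))) (derivative-e (Pointwise.tabulate⁺ dx) (suc (toℕ i))))

field₁ field₂ : ∀ {ρ} → VectorField ρ
field₁ {ρ} = record
  { order = 1
  ; powerSum = P₁
  ; image = D₁
  ; powerSum-sound = λ g r → trans (sym (act-p₁ (λ i → mon {ρ} (ray i (+ 1))) g r)) (sym (at poly-P₁ g r))
  ; image-sound = derivative-elems (λ x → x ⊗ x) D₁
      (λ j → derivative-resp (≈-sym (mon-ray j (+ 1) (+ 1))) (derivative-mon j)) poly-D₁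
  }
field₂ {ρ} = record
  { order = 2
  ; powerSum = P₂
  ; image = D₂
  ; powerSum-sound = λ g r → trans
      (sum-cong-≗ (λ i → cong g (sym (⊖-ray r i (+ 1) (+ 1)))))
      (trans (sym (act-p₂ (λ i → mon {ρ} (ray i (+ 1))) g r)) (sym (at poly-P₂ g r)))
  ; image-sound = derivative-elems (λ x → x ⊗ (x ⊗ x)) D₂
      (λ j → derivative-resp
        (≈-sym (≈-trans (*-congˡ (mon-ray j (+ 1) (+ 1))) (mon-ray j (+ 1) (+ 2)))) (derivative-mon j))
      poly-D₂
  }

opaque
  -- Opaque, since unfolding U m α for a concrete α expands the product.
  U : ∀ {ρ} → ℤ → Vec ℕ ρ → ℤ
  U m α = coeff m (mono elems α)

shifted : ∀ {n} → (Vec ℕ n → ℤ) → Vec ℕ n → Vec ℕ n → ℤ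
shifted V α β = V (zipWith _+ℕ_ α β)

module _ {ρ} (F : VectorField ρ) where
  open VectorField F

  opaque
   unfolding U
   relation : ∀ m α → (m - + order) * evalᵗ (shifted (U m) α) powerSum
                    ≡ sum (λ i → + lookup α i * evalᵗ (shifted (U m) (lower i α)) (image (suc (toℕ i))))
   relation m α = begin
     (m - + order) * evalᵗ (shifted (U m) α) powerSum
       ≡⟨ cong ((m - + order) *_) (coeff-poly m elems α powerSum) ⟨
     (m - + order) * coeff m (mono elems α ⊗ poly elems powerSum)
       ≡⟨ cong ((m - + order) *_)
            -- `powerSum-sound` needs the power sum as the outer operator, acting on the coefficient
            -- function of the monomial.
            (trans (act-comm (mono elems α) (poly elems powerSum) δ _) (sym (powerSum-sound _ _))) ⟩
     (m - + order) * sum (λ i → coeff m (mon (ray i (+ order)) ⊗ mono elems α))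
       ≡⟨ derivative-coeff (+ order) m (mono elems α)
            (derivative-mono elems (λ i → poly elems (image (suc (toℕ i)))) image-sound α) ⟩
     coeff m (⨁ {ρ} {ρ} λ i → con (+ lookup α i) ⊗ (mono elems (lower i α) ⊗ poly elems (image (suc (toℕ i)))))
       ≡⟨ coeff-⨁ m (λ i → con (+ lookup α i) ⊗ (mono elems (lower i α) ⊗ poly elems (image (suc (toℕ i))))) ⟩
     sum (λ i → + lookup α i * coeff m (mono elems (lower i α) ⊗ poly elems (image (suc (toℕ i)))))
       ≡⟨ sum-cong-≗ (λ i → cong (+ lookup α i *_) (coeff-poly m elems (lower i α) (image (suc (toℕ i))))) ⟩
     sum (λ i → + lookup α i * evalᵗ (shifted (U m) (lower i α)) (image (suc (toℕ i)))) ∎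
     where open ≡-Reasoning

-- The reflection xᵢ ↦ xᵢ⁻¹

neg : ∀ {ρ} → Vec ℤ ρ → Vec ℤ ρ
neg = Vec.map (-_)

inv : ∀ {ρ} → Laurent ρ → Laurent ρ
inv (con c) = con c
inv (mon v) = mon (neg v)
inv (f ⊕ h) = inv f ⊕ inv h
inv (f ⊗ h) = inv f ⊗ inv h

neg-involutive : ∀ {ρ} (r : Vec ℤ ρ) → neg (neg r) ≡ r
neg-involutive []      = refl
neg-involutive (x ∷ r) = cong₂ _∷_ (ℤₚ.neg-involutive x) (neg-involutive r)

neg-⊖ : ∀ {ρ} (r v : Vec ℤ ρ) → r ⊖ neg v ≡ neg (neg r ⊖ v)
neg-⊖ []      []      = refl
neg-⊖ (x ∷ r) (y ∷ v) = cong₂ _∷_ (lem x y) (neg-⊖ r v)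
  where
  lem : ∀ x y → x - - y ≡ - (- x - y)
  lem = solve-∀

⊖-neg-cancel : ∀ {ρ} (r v : Vec ℤ ρ) → r ⊖ v ⊖ neg v ≡ r
⊖-neg-cancel []      []      = refl
⊖-neg-cancel (x ∷ r) (y ∷ v) = cong₂ _∷_ (lem x y) (⊖-neg-cancel r v)
  where
  lem : ∀ x y → x - y - - y ≡ x
  lem = solve-∀

-- The reflection is conjugation by r ↦ -r on coefficient functions; for products the two inner
-- negations cancel.
act-inv : ∀ {ρ} (f : Laurent ρ) g r → act (inv f) g r ≡ act f (g ∘ neg) (neg r)
act-inv (con c) g r = cong (λ s → c * g s) (sym (neg-involutive r))
act-inv (mon v) g r = cong g (neg-⊖ r v)
act-inv (f ⊕ h) g r = cong₂ _+_ (act-inv f g r) (act-inv h g r)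
act-inv (f ⊗ h) g r = trans (act-inv f (act (inv h) g) r) (act-cong f
  (λ s → trans (act-inv h g (neg s)) (cong (act h (g ∘ neg)) (neg-involutive s))) (neg r))

neg-replicate : ∀ ρ m → neg (replicate ρ m) ≡ replicate ρ (- m)
neg-replicate ρ m = Vecₚ.map-replicate (-_) m ρ

δ-neg : ∀ {ρ} (r : Vec ℤ ρ) → δ (neg r) ≡ δ r
δ-neg {ρ} r with neg r ≟ⱽ replicate ρ (+ 0) | r ≟ⱽ replicate ρ (+ 0)
... | yes _ | yes _ = refl
... | no  _ | no  _ = refl
... | yes p | no ¬q = contradiction (trans (sym (neg-involutive r)) (trans (cong neg p) (neg-replicate ρ (+ 0)))) ¬q
... | no ¬p | yes q = contradiction (trans (cong neg q) (neg-replicate ρ (+ 0))) ¬p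

coeff-inv : ∀ {ρ} m (f : Laurent ρ) → coeff m (inv f) ≡ coeff (- m) f
coeff-inv {ρ} m f = begin
  act (inv f) δ (replicate ρ m)          ≡⟨ act-inv f δ _ ⟩
  act f (δ ∘ neg) (neg (replicate ρ m))  ≡⟨ act-cong f δ-neg _ ⟩
  act f δ (neg (replicate ρ m))          ≡⟨ cong (act f δ) (neg-replicate ρ m) ⟩
  act f δ (replicate ρ (- m))            ∎
  where open ≡-Reasoning

inv-^ : ∀ {ρ} (f : Laurent ρ) n → inv (f ^ n) ≡ inv f ^ n
inv-^ f zero    = refl
inv-^ f (suc n) = cong (inv f ⊗_) (inv-^ f n)

inv-e : ∀ {ρ} (xs : List (Laurent ρ)) j → e (List.map inv xs) j ≡ inv (e xs j)
inv-e []       zero    = refl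
inv-e (x ∷ xs) zero    = refl
inv-e []       (suc j) = refl
inv-e (x ∷ xs) (suc j) = cong₂ _⊕_ (inv-e xs (suc j)) (cong (inv x ⊗_) (inv-e xs j))

vars-inverse : ∀ {ρ n} (v : Fin n → Vec ℤ ρ) →
               Pointwise (λ x y → x ⊗ y ≈ con (+ 1)) (List.tabulate (mon ∘ v)) (List.map inv (List.tabulate (mon ∘ v)))
vars-inverse {n = zero}  v = []
vars-inverse {n = suc n} v =
  equal (λ g r → trans (cong g (⊖-neg-cancel r (v zero))) (sym (ℤₚ.*-identityˡ (g r)))) ∷ vars-inverse (v ∘ suc)

e-reflect : ∀ {ρ} j l → j +ℕ l ≡ ρ → e (vars {ρ}) j ≈ prod vars ⊗ inv (e vars l)
e-reflect {ρ} j l eq = subst (λ f → e vars j ≈ prod vars ⊗ f) (inv-e vars l)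
  (e-reciprocal (vars-inverse (λ i → ray i (+ 1))) j l
    (trans eq (sym (Listₚ.length-tabulate (λ i → mon {ρ} (ray i (+ 1)))))))

e-top : ∀ {ρ} → e (vars {ρ}) ρ ≈ prod vars
e-top {ρ} = ≈-trans (e-reflect ρ 0 (ℕₚ.+-identityʳ ρ)) (*-identityʳ _)

-- The embedding that adds a new first variable. It supports inductions on the number of variables,
-- since the tail of `vars` consists of lifted variables.
lift : ∀ {ρ} → Laurent ρ → Laurent (suc ρ)
lift (con c) = con c
lift (mon v) = mon (+ 0 ∷ v)
lift (f ⊕ h) = lift f ⊕ lift h
lift (f ⊗ h) = lift f ⊗ lift h

act-lift : ∀ {ρ} (f : Laurent ρ) g z r → act (lift f) g (z ∷ r) ≡ act f (λ s → g (z ∷ s)) r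
act-lift (con c) g z r = refl
act-lift (mon v) g z r = cong (λ y → g (y ∷ (r ⊖ v))) (ℤₚ.+-identityʳ z)
act-lift (f ⊕ h) g z r = cong₂ _+_ (act-lift f g z r) (act-lift h g z r)
act-lift (f ⊗ h) g z r = trans (act-lift f (act (lift h) g) z r) (act-cong f (act-lift h g z) r)

tail-vars : ∀ {ρ} → List (Laurent (suc ρ))
tail-vars {ρ} = List.tabulate (λ (i : Fin ρ) → mon (ray (suc i) (+ 1)))

tail-vars≡lift : ∀ {ρ} → tail-vars ≡ List.map lift (vars {ρ})
tail-vars≡lift {ρ} = sym (Listₚ.map-tabulate (λ (i : Fin ρ) → mon (ray i (+ 1))) lift)

prod-lift : ∀ {ρ} (xs : List (Laurent ρ)) → prod (List.map lift xs) ≡ lift (prod xs)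
prod-lift []       = refl
prod-lift (x ∷ xs) = cong (lift x ⊗_) (prod-lift xs)

prod-vars : ∀ {ρ} g r → act (prod (vars {ρ})) g r ≡ g (r ⊖ replicate ρ (+ 1))
prod-vars {zero}  g []      = ℤₚ.*-identityˡ (g [])
prod-vars {suc ρ} g (z ∷ r) = begin
  act (prod tail-vars) g (z - + 1 ∷ r ⊖ replicate ρ (+ 0))
    ≡⟨ cong₂ (λ f s → act f g (z - + 1 ∷ s)) (trans (cong prod (tail-vars≡lift {ρ})) (prod-lift vars)) (⊖-identityʳ r) ⟩
  act (lift (prod vars)) g (z - + 1 ∷ r)
    ≡⟨ act-lift (prod vars) g (z - + 1) r ⟩
  act (prod vars) (λ s → g (z - + 1 ∷ s)) r
    ≡⟨ prod-vars (λ s → g (z - + 1 ∷ s)) r ⟩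
  g (z - + 1 ∷ r ⊖ replicate ρ (+ 1)) ∎
  where open ≡-Reasoning

coeff-prod^ : ∀ {ρ} m n (f : Laurent ρ) → coeff m (prod vars ^ n ⊗ f) ≡ coeff (m - + n) f
coeff-prod^ {ρ} m zero f = trans (ℤₚ.*-identityˡ _) (cong (λ z → coeff z f) (sym (ℤₚ.+-identityʳ m)))
coeff-prod^ {ρ} m (suc n) f = begin
  act (prod vars) (act (prod vars ^ n ⊗ f) δ) (replicate ρ m)
    ≡⟨ prod-vars _ (replicate ρ m) ⟩
  act (prod vars ^ n ⊗ f) δ (replicate ρ m ⊖ replicate ρ (+ 1))
    ≡⟨ cong (act (prod vars ^ n ⊗ f) δ) (Vecₚ.zipWith-replicate {n = ρ} _-_ m (+ 1)) ⟩
  coeff (m - + 1) (prod vars ^ n ⊗ f)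
    ≡⟨ coeff-prod^ (m - + 1) n f ⟩
  coeff (m - + 1 - + n) f
    ≡⟨ cong (λ z → coeff z f) (lem m (+ n)) ⟩
  coeff (m - + suc n) f ∎
  where
  open ≡-Reasoning
  lem : ∀ m n → m - + 1 - n ≡ m - (+ 1 + n)
  lem = solve-∀

module _ where
  open import Algebra.Properties.CommutativeSemiring.Exp (commutativeSemiring {6}) using (^-distrib-*; ^-congˡ)
  open import Algebra.Solver.Ring.NaturalCoefficients.Default (commutativeSemiring {6})
    using (solve; _:=_; _:*_) renaming (con to :con)

  private
    X : Laurent 6
    X = prod vars

    ε : ℕ → Laurent 6
    ε = e vars

    reflect-^ : ∀ j l → j +ℕ l ≡ 6 → ∀ n → ε j ^ n ≈ X ^ n ⊗ inv (ε l ^ n)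
    reflect-^ j l eq n = ≈-trans (^-congˡ n (e-reflect j l eq))
      (subst (λ f → (X ⊗ inv (ε l)) ^ n ≈ X ^ n ⊗ f) (sym (inv-^ (ε l) n)) (^-distrib-* X (inv (ε l)) n))

    coeff-X^s : ∀ m ns h → coeff m (List.foldr (λ n f → X ^ n ⊗ f) h ns) ≡ coeff (List.foldl (λ z n → z - + n) m ns) h
    coeff-X^s m []       h = refl
    coeff-X^s m (n ∷ ns) h =
      trans (coeff-prod^ m n (List.foldr (λ n f → X ^ n ⊗ f) h ns)) (coeff-X^s (m - + n) ns h)

  opaque
   unfolding U

   U-e₆ : ∀ m a b t c d u → U m (a ∷ b ∷ t ∷ c ∷ d ∷ u ∷ []) ≡ U (m - + u) (a ∷ b ∷ t ∷ c ∷ d ∷ 0 ∷ [])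
   U-e₆ m a b t c d u = trans
     (coeff-cong m (≈-trans
       (*-congˡ (*-congˡ (*-congˡ (*-congˡ (*-congˡ (*-congʳ (^-congˡ u e-top)))))))
       (solve 6 (λ a b t c d u → a :* (b :* (t :* (c :* (d :* (u :* :con 1)))))
                   := u :* (a :* (b :* (t :* (c :* (d :* (:con 1 :* :con 1)))))))
         ≈-refl (ε 1 ^ a) (ε 2 ^ b) (ε 3 ^ t) (ε 4 ^ c) (ε 5 ^ d) (X ^ u))))
     (coeff-prod^ m u (mono elems (a ∷ b ∷ t ∷ c ∷ d ∷ 0 ∷ [])))

   -- With X = x₁⋯x₆, each eⱼ is X times the reflection of e₆₋ⱼ, so e₁ and e₅, and e₂ and e₄, trade
   -- places while e₃ stays. Extracting the powers of X lowers the index by the sum of all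
   -- exponents, and the reflection changes its sign. The hypothesis, that the exponents together
   -- with u′ add up to 2m, makes e₆ to the power u′ restore the index m.
   U-dual : ∀ m a b t c d u u′ → m - + a - + b - + t - + c - + d - + u ≡ - (m - + u′) →
            U m (a ∷ b ∷ t ∷ c ∷ d ∷ u ∷ []) ≡ U m (d ∷ c ∷ t ∷ b ∷ a ∷ u′ ∷ [])
   U-dual m a b t c d u u′ eq = begin
     U m (a ∷ b ∷ t ∷ c ∷ d ∷ u ∷ [])
       ≡⟨ coeff-cong m (≈-trans
            (*-cong (reflect-^ 1 5 refl a) (*-cong (reflect-^ 2 4 refl b) (*-cong (reflect-^ 3 3 refl t)
              (*-cong (reflect-^ 4 2 refl c) (*-cong (reflect-^ 5 1 refl d) (*-congʳ (^-congˡ u e-top)))))))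
            (solve 11 (λ xa ia xb ib xt it xc ic xd id xu →
                (xa :* ia) :* ((xb :* ib) :* ((xt :* it) :* ((xc :* ic) :* ((xd :* id) :* (xu :* :con 1)))))
                := xa :* (xb :* (xt :* (xc :* (xd :* (xu :* (id :* (ic :* (it :* (ib :* (ia :* (:con 1 :* :con 1))))))))))))
              ≈-refl (X ^ a) (inv (ε 5 ^ a)) (X ^ b) (inv (ε 4 ^ b)) (X ^ t) (inv (ε 3 ^ t))
                     (X ^ c) (inv (ε 2 ^ c)) (X ^ d) (inv (ε 1 ^ d)) (X ^ u))) ⟩
     coeff m (X ^ a ⊗ (X ^ b ⊗ (X ^ t ⊗ (X ^ c ⊗ (X ^ d ⊗ (X ^ u ⊗ inv h))))))
       ≡⟨ coeff-X^s m (a ∷ b ∷ t ∷ c ∷ d ∷ u ∷ []) (inv h) ⟩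
     coeff (m - + a - + b - + t - + c - + d - + u) (inv h)
       ≡⟨ cong (λ z → coeff z (inv h)) eq ⟩
     coeff (- (m - + u′)) (inv h)
       ≡⟨ coeff-inv (- (m - + u′)) h ⟩
     coeff (- - (m - + u′)) h
       ≡⟨ cong (λ z → coeff z h) (ℤₚ.neg-involutive (m - + u′)) ⟩
     U (m - + u′) (d ∷ c ∷ t ∷ b ∷ a ∷ 0 ∷ [])
       ≡⟨ U-e₆ m d c t b a u′ ⟨
     U m (d ∷ c ∷ t ∷ b ∷ a ∷ u′ ∷ []) ∎
     where
     open ≡-Reasoning
     h : Laurent 6
     h = mono elems (d ∷ c ∷ t ∷ b ∷ a ∷ 0 ∷ [])

-- Linear forms over ℤ[x] and their verification by computation

-- Integer polynomials in one variable, by increasing degree.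
Poly : Set
Poly = List ℤ

ev : Poly → ℤ → ℤ
ev []      x = + 0
ev (c ∷ p) x = c + x * ev p x

infixl 6 _⊞_
infixl 7 _⊠_

_⊞_ : Poly → Poly → Poly
[]      ⊞ q       = q
(c ∷ p) ⊞ []      = c ∷ p
(c ∷ p) ⊞ (d ∷ q) = c + d ∷ p ⊞ q

scaleP : ℤ → Poly → Poly
scaleP c = List.map (c *_)

_⊠_ : Poly → Poly → Poly
[]      ⊠ q = []
(c ∷ p) ⊠ q = scaleP c q ⊞ (+ 0 ∷ p ⊠ q)

shiftP : Poly → Poly
shiftP []      = []
shiftP (c ∷ p) = (c ∷ []) ⊞ (+ 1 ∷ + 1 ∷ []) ⊠ shiftP p

ev-⊞ : ∀ p q x → ev (p ⊞ q) x ≡ ev p x + ev q x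
ev-⊞ []      q       x = sym (ℤₚ.+-identityˡ _)
ev-⊞ (c ∷ p) []      x = sym (ℤₚ.+-identityʳ _)
ev-⊞ (c ∷ p) (d ∷ q) x = trans (cong (λ z → c + d + x * z) (ev-⊞ p q x)) (lem c d x (ev p x) (ev q x))
  where
  lem : ∀ c d x p q → c + d + x * (p + q) ≡ (c + x * p) + (d + x * q)
  lem = solve-∀

ev-scaleP : ∀ c p x → ev (scaleP c p) x ≡ c * ev p x
ev-scaleP c []      x = sym (ℤₚ.*-zeroʳ c)
ev-scaleP c (d ∷ p) x = trans (cong (λ z → c * d + x * z) (ev-scaleP c p x)) (lem c d x (ev p x))
  where
  lem : ∀ c d x p → c * d + x * (c * p) ≡ c * (d + x * p)
  lem = solve-∀

ev-⊠ : ∀ p q x → ev (p ⊠ q) x ≡ ev p x * ev q x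
ev-⊠ []      q x = refl
ev-⊠ (c ∷ p) q x = begin
  ev (scaleP c q ⊞ (+ 0 ∷ p ⊠ q)) x
    ≡⟨ ev-⊞ (scaleP c q) (+ 0 ∷ p ⊠ q) x ⟩
  ev (scaleP c q) x + (+ 0 + x * ev (p ⊠ q) x)
    ≡⟨ cong₂ (λ y z → y + (+ 0 + x * z)) (ev-scaleP c q x) (ev-⊠ p q x) ⟩
  c * ev q x + (+ 0 + x * (ev p x * ev q x))
    ≡⟨ lem c x (ev p x) (ev q x) ⟩
  (c + x * ev p x) * ev q x ∎
  where
  open ≡-Reasoning
  lem : ∀ c x p q → c * q + (+ 0 + x * (p * q)) ≡ (c + x * p) * q
  lem = solve-∀

ev-shiftP : ∀ p x → ev (shiftP p) x ≡ ev p (+ 1 + x)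
ev-shiftP []      x = refl
ev-shiftP (c ∷ p) x = begin
  ev ((c ∷ []) ⊞ (+ 1 ∷ + 1 ∷ []) ⊠ shiftP p) x
    ≡⟨ ev-⊞ (c ∷ []) ((+ 1 ∷ + 1 ∷ []) ⊠ shiftP p) x ⟩
  (c + x * + 0) + ev ((+ 1 ∷ + 1 ∷ []) ⊠ shiftP p) x
    ≡⟨ cong (λ z → (c + x * + 0) + z) (trans (ev-⊠ (+ 1 ∷ + 1 ∷ []) (shiftP p) x)
         (cong (ev (+ 1 ∷ + 1 ∷ []) x *_) (ev-shiftP p x))) ⟩
  (c + x * + 0) + (+ 1 + x * (+ 1 + x * + 0)) * ev p (+ 1 + x)
    ≡⟨ lem c x (ev p (+ 1 + x)) ⟩
  c + (+ 1 + x) * ev p (+ 1 + x) ∎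
  where
  open ≡-Reasoning
  lem : ∀ c x y → (c + x * + 0) + (+ 1 + x * (+ 1 + x * + 0)) * y ≡ c + (+ 1 + x) * y
  lem = solve-∀

-- Lists of coefficients are not trimmed, so the zero polynomial may appear as any list of zeros.
isZero : Poly → Bool
isZero []      = true
isZero (c ∷ p) = does (c ℤₚ.≟ + 0) ∧ isZero p

ev-isZero : ∀ p x → isZero p ≡ true → ev p x ≡ + 0
ev-isZero []      x eq = refl
ev-isZero (c ∷ p) x eq with c ℤₚ.≟ + 0
... | yes refl = trans (ℤₚ.+-identityˡ _) (trans (cong (x *_) (ev-isZero p x eq)) (ℤₚ.*-zeroʳ x))

-- Used twice: for relations between coefficients of monomials in the eⱼ, and for relations between
-- terms of the two sequences.
module LinearForm {K : Set} (_≟_ : DecidableEquality K) where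

  -- Linear forms in unknowns indexed by K, with coefficients in ℤ[x].
  Form : Set
  Form = List (Poly × K)

  value : (K → ℤ) → ℤ → Form → ℤ
  value V x []            = + 0
  value V x ((p , k) ∷ f) = ev p x * V k + value V x f

  scale : Poly → Form → Form
  scale p = List.map (λ (q , k) → p ⊠ q , k)

  combine : ∀ {A : Set} → (A → Form) → List (Poly × A) → Form
  combine toForm []             = []
  combine toForm ((p , a) ∷ ps) = scale p (toForm a) ++ combine toForm ps

  insert : Poly → K → Form → Form
  insert p k [] = (p , k) ∷ []
  insert p k ((q , l) ∷ f) with k ≟ l
  ... | yes _ = (p ⊞ q , l) ∷ f
  ... | no  _ = (q , l) ∷ insert p k f

  -- `canon` sends unknowns known to be equal to a common representative before like terms are
  -- merged. For monomials it carries the reflection symmetry.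
  collect : (K → K) → Form → Form
  collect canon []            = []
  collect canon ((p , k) ∷ f) = insert p (canon k) (collect canon f)

  vanishes : Form → Bool
  vanishes []            = true
  vanishes ((p , _) ∷ f) = isZero p ∧ vanishes f

  module _ (V : K → ℤ) (x : ℤ) where

    value-++ : ∀ f g → value V x (f ++ g) ≡ value V x f + value V x g
    value-++ []            g = sym (ℤₚ.+-identityˡ _)
    value-++ ((p , k) ∷ f) g =
      trans (cong (λ z → ev p x * V k + z) (value-++ f g)) (sym (ℤₚ.+-assoc (ev p x * V k) _ _))

    value-scale : ∀ p f → value V x (scale p f) ≡ ev p x * value V x f
    value-scale p []            = sym (ℤₚ.*-zeroʳ (ev p x))
    value-scale p ((q , k) ∷ f) =
      trans (cong₂ (λ y z → y * V k + z) (ev-⊠ p q x) (value-scale p f)) (lem (ev p x) (ev q x) (V k) (value V x f))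
      where
      lem : ∀ p q v y → p * q * v + p * y ≡ p * (q * v + y)
      lem = solve-∀

    value-insert : ∀ p k f → value V x (insert p k f) ≡ ev p x * V k + value V x f
    value-insert p k [] = refl
    value-insert p k ((q , l) ∷ f) with k ≟ l
    ... | yes refl = trans (cong (λ z → z * V k + value V x f) (ev-⊞ p q x)) (lem (ev p x) (ev q x) (V k) _)
      where
      lem : ∀ p q v y → (p + q) * v + y ≡ p * v + (q * v + y)
      lem = solve-∀
    ... | no _ = trans (cong (λ z → ev q x * V l + z) (value-insert p k f)) (lem (ev q x * V l) (ev p x * V k) _)
      where
      lem : ∀ a b c → a + (b + c) ≡ b + (a + c)
      lem = solve-∀

    value-collect : ∀ {canon} → (∀ k → V (canon k) ≡ V k) → ∀ f → value V x (collect canon f) ≡ value V x f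
    value-collect         inv []            = refl
    value-collect {canon} inv ((p , k) ∷ f) =
      trans (value-insert p (canon k) (collect canon f))
        (cong₂ (λ v y → ev p x * v + y) (inv k) (value-collect inv f))

    value-vanishes : ∀ f → vanishes f ≡ true → value V x f ≡ + 0
    value-vanishes []            eq = refl
    value-vanishes ((p , k) ∷ f) eq with isZero p in z
    ... | true = trans (cong₂ (λ y w → y * V k + w) (ev-isZero p x z) (value-vanishes f eq)) refl

    value-combine : ∀ {A : Set} (toForm : A → Form) → (∀ a → value V x (toForm a) ≡ + 0) →
                    ∀ ps → value V x (combine toForm ps) ≡ + 0
    value-combine toForm z []             = refl
    value-combine toForm z ((p , a) ∷ ps) = begin
      value V x (scale p (toForm a) ++ combine toForm ps)
        ≡⟨ value-++ (scale p (toForm a)) _ ⟩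
      value V x (scale p (toForm a)) + value V x (combine toForm ps)
        ≡⟨ cong₂ _+_ (trans (value-scale p (toForm a)) (trans (cong (ev p x *_) (z a)) (ℤₚ.*-zeroʳ (ev p x))))
                     (value-combine toForm z ps) ⟩
      + 0 ∎
      where open ≡-Reasoning

    -- If -f plus a ℤ[x]-combination of vanishing forms collects to zero, then f vanishes. The
    -- condition is Boolean, so for explicit data evaluation settles it.
    certificate : ∀ {A : Set} {canon} (toForm : A → Form) →
                  (∀ a → value V x (toForm a) ≡ + 0) → (∀ k → V (canon k) ≡ V k) →
                  ∀ ps f → vanishes (collect canon (scale (- (+ 1) ∷ []) f ++ combine toForm ps)) ≡ true →
                  value V x f ≡ + 0
    certificate {canon = canon} toForm z inv ps f eq = begin
      value V x f
        ≡⟨ lem x (value V x f) ⟨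
      - ((- (+ 1) + x * + 0) * value V x f + + 0)
        ≡⟨ cong (λ y → - y) (cong₂ _+_ (sym (value-scale (- (+ 1) ∷ []) f)) (sym (value-combine toForm z ps))) ⟩
      - (value V x (scale (- (+ 1) ∷ []) f) + value V x combination)
        ≡⟨ cong (λ y → - y) (value-++ (scale (- (+ 1) ∷ []) f) combination) ⟨
      - value V x (scale (- (+ 1) ∷ []) f ++ combination)
        ≡⟨ cong (λ y → - y) (value-collect inv (scale (- (+ 1) ∷ []) f ++ combination)) ⟨
      - value V x (collect canon (scale (- (+ 1) ∷ []) f ++ combination))
        ≡⟨ cong (λ y → - y) (value-vanishes (collect canon (scale (- (+ 1) ∷ []) f ++ combination)) eq) ⟩
      + 0 ∎
      where
      open ≡-Reasoning
      combination = combine toForm ps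
      lem : ∀ x y → - ((- (+ 1) + x * + 0) * y + + 0) ≡ y
      lem = solve-∀

-- Counting matrices column by column

Σᴸ : {A : Set} → (A → ℤ) → List A → ℤ
Σᴸ f []       = + 0
Σᴸ f (x ∷ xs) = f x + Σᴸ f xs

Σᴸ-cong : ∀ {A : Set} {f g : A → ℤ} → (∀ x → f x ≡ g x) → ∀ xs → Σᴸ f xs ≡ Σᴸ g xs
Σᴸ-cong f≗g []       = refl
Σᴸ-cong f≗g (x ∷ xs) = cong₂ _+_ (f≗g x) (Σᴸ-cong f≗g xs)

Σᴸ-+ : ∀ {A : Set} (f g : A → ℤ) xs → Σᴸ (λ x → f x + g x) xs ≡ Σᴸ f xs + Σᴸ g xs
Σᴸ-+ f g []       = refl
Σᴸ-+ f g (x ∷ xs) = trans (cong (λ z → f x + g x + z) (Σᴸ-+ f g xs)) (lem (f x) (g x) _ _)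
  where
  lem : ∀ a b c d → a + b + (c + d) ≡ (a + c) + (b + d)
  lem = solve-∀

Σᴸ-* : ∀ {A : Set} c (f : A → ℤ) xs → Σᴸ (λ x → c * f x) xs ≡ c * Σᴸ f xs
Σᴸ-* c f []       = sym (ℤₚ.*-zeroʳ c)
Σᴸ-* c f (x ∷ xs) = trans (cong (λ z → c * f x + z) (Σᴸ-* c f xs)) (sym (ℤₚ.*-distribˡ-+ c (f x) _))

Σᴸ-++ : ∀ {A : Set} (f : A → ℤ) xs ys → Σᴸ f (xs ++ ys) ≡ Σᴸ f xs + Σᴸ f ys
Σᴸ-++ f []       ys = sym (ℤₚ.+-identityˡ _)
Σᴸ-++ f (x ∷ xs) ys = trans (cong (λ z → f x + z) (Σᴸ-++ f xs ys)) (sym (ℤₚ.+-assoc (f x) _ _))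

Σᴸ-concatMap : ∀ {A B : Set} (f : B → ℤ) (h : A → List B) xs → Σᴸ f (concatMap h xs) ≡ Σᴸ (λ x → Σᴸ f (h x)) xs
Σᴸ-concatMap f h []       = refl
Σᴸ-concatMap f h (x ∷ xs) =
  trans (Σᴸ-++ f (h x) (concatMap h xs)) (cong (λ z → Σᴸ f (h x) + z) (Σᴸ-concatMap f h xs))

Σᴸ-map : ∀ {A B : Set} (f : B → ℤ) (h : A → B) xs → Σᴸ f (List.map h xs) ≡ Σᴸ (f ∘ h) xs
Σᴸ-map f h []       = refl
Σᴸ-map f h (x ∷ xs) = cong (λ z → f (h x) + z) (Σᴸ-map f h xs)

length-filter : ∀ {A : Set} {P : A → Set} (P? : Decidable P) xs →
                + length (filter P? xs) ≡ Σᴸ (λ x → indicator (P? x)) xs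
length-filter P? []       = refl
length-filter P? (x ∷ xs) with P? x
... | yes _ = cong (λ z → + 1 + z) (length-filter P? xs)
... | no  _ = trans (length-filter P? xs) (sym (ℤₚ.+-identityˡ _))

indicator-⇔ : ∀ {P Q : Set} → (P → Q) → (Q → P) → (p : Dec P) (q : Dec Q) → indicator p ≡ indicator q
indicator-⇔ f g (yes _) (yes _) = refl
indicator-⇔ f g (no  _) (no  _) = refl
indicator-⇔ f g (yes p) (no ¬q) = contradiction (f p) ¬q
indicator-⇔ f g (no ¬p) (yes q) = contradiction (g q) ¬p

indicator-× : ∀ {P Q : Set} (p : Dec P) (q : Dec Q) → indicator (p ×-dec q) ≡ indicator p * indicator q
indicator-× (yes _) (yes _) = refl
indicator-× (yes _) (no  _) = refl
indicator-× (no  _) (yes _) = refl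
indicator-× (no  _) (no  _) = refl

Σ-allVecs : ∀ c (f : Vec Bool (suc c) → ℤ) →
            Σᴸ f (allVecs (suc c)) ≡ Σᴸ (λ v → f (true ∷ v) + f (false ∷ v)) (allVecs c)
Σ-allVecs c f = trans (Σᴸ-concatMap f _ (allVecs c))
  (Σᴸ-cong (λ v → cong (λ z → f (true ∷ v) + z) (ℤₚ.+-identityʳ _)) (allVecs c))

Σ-allMatrices : ∀ r c (f : Matrix01 (suc r) c → ℤ) →
                Σᴸ f (allMatrices (suc r) c) ≡ Σᴸ (λ M → Σᴸ (λ row → f (row ∷ M)) (allVecs c)) (allMatrices r c)
Σ-allMatrices r c f = trans (Σᴸ-concatMap f _ (allMatrices r c))
  (Σᴸ-cong (λ M → Σᴸ-map f _ (allVecs c)) (allMatrices r c))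

-- `allMatrices` enumerates by rows, but a power of e₃ is built one column at a time; this splits
-- off the first column instead.
Σ-columns : ∀ r c (f : Matrix01 r (suc c) → ℤ) →
            Σᴸ f (allMatrices r (suc c)) ≡ Σᴸ (λ v → Σᴸ (λ M → f (zipWith _∷_ v M)) (allMatrices r c)) (allVecs r)
Σ-columns zero    c f = sym (ℤₚ.+-identityʳ _)
Σ-columns (suc r) c f = begin
  Σᴸ f (allMatrices (suc r) (suc c))
    ≡⟨ Σ-allMatrices r (suc c) f ⟩
  Σᴸ (λ M → Σᴸ (λ row → f (row ∷ M)) (allVecs (suc c))) (allMatrices r (suc c))
    ≡⟨ Σ-columns r c _ ⟩
  Σᴸ (λ v → Σᴸ (λ M → Σᴸ (λ row → f (row ∷ zipWith _∷_ v M)) (allVecs (suc c))) (allMatrices r c)) (allVecs r)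
    ≡⟨ Σᴸ-cong (λ v → Σᴸ-cong (λ M → trans (Σ-allVecs c _) (Σᴸ-+ _ _ (allVecs c))) (allMatrices r c)) (allVecs r) ⟩
  Σᴸ (λ v → Σᴸ (λ M → Σᴸ (λ row → f (zipWith _∷_ (true ∷ v) (row ∷ M))) (allVecs c)
                      + Σᴸ (λ row → f (zipWith _∷_ (false ∷ v) (row ∷ M))) (allVecs c)) (allMatrices r c)) (allVecs r)
    ≡⟨ Σᴸ-cong (λ v → trans (Σᴸ-+ _ _ (allMatrices r c))
         (sym (cong₂ _+_ (Σ-allMatrices r c (f ∘ zipWith _∷_ (true ∷ v)))
                         (Σ-allMatrices r c (f ∘ zipWith _∷_ (false ∷ v)))))) (allVecs r) ⟩
  Σᴸ (λ v → Σᴸ (f ∘ zipWith _∷_ (true ∷ v)) (allMatrices (suc r) c)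
          + Σᴸ (f ∘ zipWith _∷_ (false ∷ v)) (allMatrices (suc r) c)) (allVecs r)
    ≡⟨ Σ-allVecs r _ ⟨
  Σᴸ (λ v → Σᴸ (λ M → f (zipWith _∷_ v M)) (allMatrices (suc r) c)) (allVecs (suc r)) ∎
  where open ≡-Reasoning

Σ-no-columns : ∀ r (f : Matrix01 r 0 → ℤ) → Σᴸ f (allMatrices r 0) ≡ f (replicate r [])
Σ-no-columns zero    f = ℤₚ.+-identityʳ _
Σ-no-columns (suc r) f = trans (Σ-allMatrices r 0 f)
  (trans (Σ-no-columns r _) (ℤₚ.+-identityʳ _))

bits : ∀ {ρ} → Vec Bool ρ → Vec ℤ ρ
bits = Vec.map (λ b → + bit b)

rowSums : ∀ {r c} → Matrix01 r c → Vec ℤ r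
rowSums = Vec.map (λ row → + ones row)

-- The terms of eⱼ are the monomials whose exponent vectors are the 0-1 vectors of weight j.
-- Splitting on the first bit matches the recursion of `e` on its first variable.
Σ-weight : ∀ ρ j (g : Vec ℤ ρ → ℤ) R →
           Σᴸ (λ v → indicator (ones v ℕ.≟ j) * g (R ⊖ bits v)) (allVecs ρ) ≡ act (e vars j) g R
Σ-weight zero    zero    g [] = ℤₚ.+-identityʳ _
Σ-weight zero    (suc j) g [] = refl
Σ-weight (suc ρ) zero g (z ∷ R) = begin
  Σᴸ (λ v → indicator (ones v ℕ.≟ 0) * g ((z ∷ R) ⊖ bits v)) (allVecs (suc ρ))
    ≡⟨ Σ-allVecs ρ _ ⟩
  Σᴸ (λ v → + 0 * g ((z - + 1) ∷ (R ⊖ bits v)) + indicator (ones v ℕ.≟ 0) * g ((z - + 0) ∷ (R ⊖ bits v))) (allVecs ρ)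
    ≡⟨ Σᴸ-cong (λ v → trans (ℤₚ.+-identityˡ _)
         (cong (λ y → indicator (ones v ℕ.≟ 0) * g (y ∷ (R ⊖ bits v))) (ℤₚ.+-identityʳ z))) (allVecs ρ) ⟩
  Σᴸ (λ v → indicator (ones v ℕ.≟ 0) * g (z ∷ (R ⊖ bits v))) (allVecs ρ)
    ≡⟨ Σ-weight ρ zero (λ s → g (z ∷ s)) R ⟩
  act (e (vars {ρ}) 0) (λ s → g (z ∷ s)) R
    ≡⟨⟩
  + 1 * g (z ∷ R) ∎
  where open ≡-Reasoning
Σ-weight (suc ρ) (suc j) g (z ∷ R) = begin
  Σᴸ (λ v → indicator (ones v ℕ.≟ suc j) * g ((z ∷ R) ⊖ bits v)) (allVecs (suc ρ))
    ≡⟨ Σ-allVecs ρ _ ⟩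
  Σᴸ (λ v → indicator (suc (ones v) ℕ.≟ suc j) * g ((z - + 1) ∷ (R ⊖ bits v))
          + indicator (ones v ℕ.≟ suc j) * g ((z - + 0) ∷ (R ⊖ bits v))) (allVecs ρ)
    ≡⟨ Σᴸ-cong (λ v → trans
         (ℤₚ.+-comm (indicator (suc (ones v) ℕ.≟ suc j) * g ((z - + 1) ∷ (R ⊖ bits v))) _) (cong₂ _+_
         (cong (λ y → indicator (ones v ℕ.≟ suc j) * g (y ∷ (R ⊖ bits v))) (ℤₚ.+-identityʳ z))
         (cong (λ y → y * g ((z - + 1) ∷ (R ⊖ bits v)))
           (indicator-⇔ ℕₚ.suc-injective (cong suc) (suc (ones v) ℕ.≟ suc j) (ones v ℕ.≟ j))))) (allVecs ρ) ⟩
  Σᴸ (λ v → indicator (ones v ℕ.≟ suc j) * g (z ∷ (R ⊖ bits v))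
          + indicator (ones v ℕ.≟ j) * g ((z - + 1) ∷ (R ⊖ bits v))) (allVecs ρ)
    ≡⟨ Σᴸ-+ _ _ (allVecs ρ) ⟩
  Σᴸ (λ v → indicator (ones v ℕ.≟ suc j) * g (z ∷ (R ⊖ bits v))) (allVecs ρ)
    + Σᴸ (λ v → indicator (ones v ℕ.≟ j) * g ((z - + 1) ∷ (R ⊖ bits v))) (allVecs ρ)
    ≡⟨ cong₂ _+_ (Σ-weight ρ (suc j) (λ s → g (z ∷ s)) R) (Σ-weight ρ j (λ s → g ((z - + 1) ∷ s)) R) ⟩
  act (e vars (suc j)) (λ s → g (z ∷ s)) R + act (e vars j) (λ s → g ((z - + 1) ∷ s)) R
    ≡⟨ cong₂ _+_ (act-lift (e vars (suc j)) g z R) (act-lift (e vars j) g (z - + 1) R) ⟨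
  act (lift (e vars (suc j))) g (z ∷ R) + act (lift (e vars j)) g ((z - + 1) ∷ R)
    ≡⟨ cong₂ (λ f s → act f g (z ∷ R) + act (lift (e vars j)) g ((z - + 1) ∷ s)) (e-tail (suc j)) (⊖-identityʳ R) ⟨
  act (e tail-vars (suc j)) g (z ∷ R) + act (lift (e vars j)) g ((z - + 1) ∷ (R ⊖ replicate ρ (+ 0)))
    ≡⟨ cong (λ f → act (e tail-vars (suc j)) g (z ∷ R) + act f g ((z - + 1) ∷ (R ⊖ replicate ρ (+ 0)))) (e-tail j) ⟨
  act (e vars (suc j)) g (z ∷ R) ∎
  where
  open ≡-Reasoning
  e-lift : ∀ (xs : List (Laurent ρ)) k → e (List.map lift xs) k ≡ lift (e xs k)
  e-lift []       zero    = refl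
  e-lift (x ∷ xs) zero    = refl
  e-lift []       (suc k) = refl
  e-lift (x ∷ xs) (suc k) = cong₂ _⊕_ (e-lift xs (suc k)) (cong (lift x ⊗_) (e-lift xs k))
  e-tail : ∀ k → e tail-vars k ≡ lift (e (vars {ρ}) k)
  e-tail k = trans (cong (λ xs → e xs k) (tail-vars≡lift {ρ})) (e-lift vars k)

-- Arbitrary integer vectors are allowed as row sums, so that removing a column is a plain
-- subtraction; a negative entry gives the count 0.
count : ∀ {ρ} c → Vec ℤ ρ → ℤ
count {ρ} c R = Σᴸ (λ M → indicator (rowSums M ≟ⱽ R) * indicator (allEq? 3 (colSums M))) (allMatrices ρ c)

rowSums-zip : ∀ {r c} (v : Vec Bool r) (M : Matrix01 r c) R →
              (rowSums (zipWith _∷_ v M) ≡ R → rowSums M ≡ R ⊖ bits v) ×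
              (rowSums M ≡ R ⊖ bits v → rowSums (zipWith _∷_ v M) ≡ R)
rowSums-zip [] [] [] = (λ _ → refl) , (λ _ → refl)
rowSums-zip (b ∷ v) (row ∷ M) (z ∷ R) =
  (λ { eq → cong₂ _∷_ (trans (lem₁ (+ bit b) (+ ones row)) (cong (_- + bit b) (Vecₚ.∷-injectiveˡ eq)))
                      (proj₁ (rowSums-zip v M R) (Vecₚ.∷-injectiveʳ eq)) }) ,
  (λ { eq → cong₂ _∷_ (trans (cong (λ y → + bit b + y) (Vecₚ.∷-injectiveˡ eq)) (lem₂ (+ bit b) z))
                      (proj₂ (rowSums-zip v M R) (Vecₚ.∷-injectiveʳ eq)) })
  where
  lem₁ : ∀ b o → o ≡ (b + o) - b
  lem₁ = solve-∀
  lem₂ : ∀ b z → b + (z - b) ≡ z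
  lem₂ = solve-∀

colSums-zip : ∀ {r c} (v : Vec Bool r) (M : Matrix01 r c) → colSums (zipWith _∷_ v M) ≡ ones v ∷ colSums M
colSums-zip []      []        = refl
colSums-zip (b ∷ v) (row ∷ M) = cong (zipWith _+ℕ_ (Vec.map bit (b ∷ row))) (colSums-zip v M)

indicator-allEq-[] : ∀ k (v : Vec ℕ 0) → indicator (allEq? k v) ≡ + 1
indicator-allEq-[] k [] = refl

count-zero : ∀ {ρ} (R : Vec ℤ ρ) → count 0 R ≡ δ R
count-zero {ρ} R = begin
  count 0 R
    ≡⟨ Σ-no-columns ρ _ ⟩
  indicator (rowSums (replicate ρ []) ≟ⱽ R) * indicator (allEq? 3 (colSums {ρ} (replicate ρ [])))
    ≡⟨ cong (indicator (rowSums (replicate ρ []) ≟ⱽ R) *_) (indicator-allEq-[] 3 (colSums {ρ} (replicate ρ []))) ⟩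
  indicator (rowSums (replicate ρ []) ≟ⱽ R) * + 1
    ≡⟨ ℤₚ.*-identityʳ _ ⟩
  indicator (rowSums (replicate ρ []) ≟ⱽ R)
    ≡⟨ indicator-⇔ (λ eq → trans (sym eq) empty) (λ eq → trans empty (sym eq))
         (rowSums (replicate ρ []) ≟ⱽ R) (R ≟ⱽ replicate ρ (+ 0)) ⟩
  δ R ∎
  where
  open ≡-Reasoning
  empty : rowSums (replicate ρ []) ≡ replicate ρ (+ 0)
  empty = Vecₚ.map-replicate _ [] ρ

count-suc : ∀ {ρ} c (R : Vec ℤ ρ) → count (suc c) R ≡ act (e vars 3) (count c) R
count-suc {ρ} c R = begin
  count (suc c) R
    ≡⟨ Σ-columns ρ c _ ⟩
  Σᴸ (λ v → Σᴸ (λ M → indicator (rowSums (zipWith _∷_ v M) ≟ⱽ R)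
                      * indicator (allEq? 3 (colSums (zipWith _∷_ v M)))) (allMatrices ρ c)) (allVecs ρ)
    ≡⟨ Σᴸ-cong (λ v → trans (Σᴸ-cong (step v) (allMatrices ρ c))
                             (Σᴸ-* (indicator (ones v ℕ.≟ 3)) _ (allMatrices ρ c))) (allVecs ρ) ⟩
  Σᴸ (λ v → indicator (ones v ℕ.≟ 3) * count c (R ⊖ bits v)) (allVecs ρ)
    ≡⟨ Σ-weight ρ 3 (count c) R ⟩
  act (e vars 3) (count c) R ∎
  where
  open ≡-Reasoning
  lem : ∀ a b c → a * (b * c) ≡ b * (a * c)
  lem = solve-∀
  step : ∀ v M → indicator (rowSums (zipWith _∷_ v M) ≟ⱽ R) * indicator (allEq? 3 (colSums (zipWith _∷_ v M)))
               ≡ indicator (ones v ℕ.≟ 3) * (indicator (rowSums M ≟ⱽ (R ⊖ bits v)) * indicator (allEq? 3 (colSums M)))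
  step v M = trans
    (cong₂ _*_
      (indicator-⇔ (proj₁ (rowSums-zip v M R)) (proj₂ (rowSums-zip v M R))
        (rowSums (zipWith _∷_ v M) ≟ⱽ R) (rowSums M ≟ⱽ (R ⊖ bits v)))
      (trans (cong (λ s → indicator (allEq? 3 s)) (colSums-zip v M))
        (indicator-× (ones v ℕ.≟ 3) (allEq? 3 (colSums M)))))
    (lem (indicator (rowSums M ≟ⱽ (R ⊖ bits v))) (indicator (ones v ℕ.≟ 3)) _)

count-act : ∀ {ρ} c (R : Vec ℤ ρ) → count c R ≡ act (e vars 3 ^ c) δ R
count-act zero    R = trans (count-zero R) (sym (ℤₚ.*-identityˡ _))
count-act (suc c) R = trans (count-suc c R) (act-cong (e vars 3) (count-act c) R)

AllEq⇒≡ : ∀ {r c} n (M : Matrix01 r c) → AllEq n (Vec.map ones M) → rowSums M ≡ replicate r (+ n)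
AllEq⇒≡ n []        _        = refl
AllEq⇒≡ n (row ∷ M) (p , ps) = cong₂ _∷_ (cong +_ p) (AllEq⇒≡ n M ps)

≡⇒AllEq : ∀ {r c} n (M : Matrix01 r c) → rowSums M ≡ replicate r (+ n) → AllEq n (Vec.map ones M)
≡⇒AllEq n []        _  = _
≡⇒AllEq n (row ∷ M) eq = ℤₚ.+-injective (Vecₚ.∷-injectiveˡ eq) , ≡⇒AllEq n M (Vecₚ.∷-injectiveʳ eq)

a-coeff : ∀ n → + a n ≡ coeff (+ n) (e (vars {6}) 3 ^ (2 ℕ.* n))
a-coeff n = begin
  + a n
    ≡⟨ length-filter (good? n) (allMatrices 6 (2 ℕ.* n)) ⟩
  Σᴸ (λ M → indicator (good? n M)) (allMatrices 6 (2 ℕ.* n))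
    ≡⟨ Σᴸ-cong (λ M → trans (indicator-× (allEq? n (Vec.map ones M)) (allEq? 3 (colSums M)))
         (cong (_* indicator (allEq? 3 (colSums M)))
           (indicator-⇔ (AllEq⇒≡ n M) (≡⇒AllEq n M)
             (allEq? n (Vec.map ones M)) (rowSums M ≟ⱽ replicate 6 (+ n))))) (allMatrices 6 (2 ℕ.* n)) ⟩
  count (2 ℕ.* n) (replicate 6 (+ n))
    ≡⟨ count-act (2 ℕ.* n) _ ⟩
  coeff (+ n) (e vars 3 ^ (2 ℕ.* n)) ∎
  where open ≡-Reasoning

-- The two recurrences and the elimination

module Monomial = LinearForm (Vecₚ.≡-dec {A = ℕ} {n = 6} ℕₚ._≟_)
module Linear = LinearForm (Sumₚ.≡-dec ℕₚ._≟_ ℕₚ._≟_)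

-- The coefficient of (x₁⋯x₆)ⁿ⁺¹ in e₂ e₄ e₃²ⁿ.
companion : ℕ → ℤ
companion n = U (+ suc n) (0 ∷ 1 ∷ 2 ℕ.* n ∷ 1 ∷ 0 ∷ 0 ∷ [])

unknown : ℕ → ℕ ⊎ ℕ → ℤ
unknown n (inj₁ j) = + a (n +ℕ j)
unknown n (inj₂ j) = companion (n +ℕ j)

-- Since form-I starts at a(n+1) and stops at b(n+1), three consecutive shifts of it and two of
-- form-II involve only a(n), ..., a(n+4) and b(n), ..., b(n+3). Five relations suffice to eliminate
-- four values of b, which explains the order 4 of the result.
form-I form-II : Linear.Form
form-I =
    ((- + 504 ∷ - + 768 ∷ - + 306 ∷ - + 12 ∷ []) , inj₁ 1)
  ∷ ((+ 24 ∷ + 36 ∷ + 18 ∷ + 3 ∷ []) , inj₁ 2)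
  ∷ ((- + 384 ∷ - + 1408 ∷ - + 1536 ∷ - + 512 ∷ []) , inj₂ 0)
  ∷ ((- + 24 ∷ - + 40 ∷ - + 22 ∷ - + 4 ∷ []) , inj₂ 1)
  ∷ []
form-II =
    ((- + 57600 ∷ - + 268800 ∷ - + 456000 ∷ - + 360000 ∷ - + 134400 ∷ - + 19200 ∷ []) , inj₁ 0)
  ∷ ((- + 74304 ∷ - + 128448 ∷ - + 36336 ∷ + 43248 ∷ + 28800 ∷ + 4800 ∷ []) , inj₁ 1)
  ∷ ((- + 23736 ∷ - + 41100 ∷ - + 26592 ∷ - + 7620 ∷ - + 816 ∷ []) , inj₁ 2)
  ∷ ((- + 162048 ∷ - + 723200 ∷ - + 1146816 ∷ - + 825792 ∷ - + 274176 ∷ - + 34048 ∷ []) , inj₂ 0)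
  ∷ ((- + 58944 ∷ - + 144896 ∷ - + 141008 ∷ - + 67952 ∷ - + 16224 ∷ - + 1536 ∷ []) , inj₂ 1)
  ∷ ((+ 648 ∷ + 1188 ∷ + 864 ∷ + 312 ∷ + 56 ∷ + 4 ∷ []) , inj₂ 2)
  ∷ []

-- Solutions over ℤ[n] of the linear systems expressing that all unknowns except those of form-I and
-- form-II cancel.  An entry (q , F , α) stands for q times the relation that F yields for the
-- monomial e^α, where the exponent of e₃ is counted from 2n and coefficients are taken at (x₁⋯x₆)ⁿ⁺⁵.
certificate-I certificate-II : List (Poly × VectorField 6 × Vec ℕ 6)
certificate-I =
    ((+ 84 ∷ + 128 ∷ + 63 ∷ + 10 ∷ []) , field₁ , (0 ∷ 0 ∷ 2 ∷ 0 ∷ 1 ∷ 3 ∷ []))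
  ∷ ((+ 96 ∷ + 160 ∷ + 64 ∷ []) , field₁ , (0 ∷ 1 ∷ 1 ∷ 0 ∷ 0 ∷ 4 ∷ []))
  ∷ ((- + 20 ∷ - + 28 ∷ - + 13 ∷ - + 2 ∷ []) , field₁ , (0 ∷ 1 ∷ 3 ∷ 0 ∷ 0 ∷ 3 ∷ []))
  ∷ ((- + 12 ∷ - + 20 ∷ - + 11 ∷ - + 2 ∷ []) , field₁ , (1 ∷ 0 ∷ 2 ∷ 1 ∷ 0 ∷ 3 ∷ []))
  ∷ ((+ 12 ∷ + 16 ∷ + 7 ∷ + 1 ∷ []) , field₁ , (2 ∷ 0 ∷ 3 ∷ 0 ∷ 0 ∷ 3 ∷ []))
  ∷ ((+ 48 ∷ + 80 ∷ + 44 ∷ + 8 ∷ []) , field₂ , (0 ∷ 0 ∷ 2 ∷ 1 ∷ 0 ∷ 3 ∷ []))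
  ∷ ((- + 12 ∷ - + 16 ∷ - + 7 ∷ - + 1 ∷ []) , field₂ , (1 ∷ 0 ∷ 3 ∷ 0 ∷ 0 ∷ 3 ∷ []))
  ∷ []
certificate-II =
    ((+ 48000 ∷ + 224000 ∷ + 380000 ∷ + 300000 ∷ + 112000 ∷ + 16000 ∷ []) , field₁ , (0 ∷ 0 ∷ 0 ∷ 0 ∷ 1 ∷ 4 ∷ []))
  ∷ ((+ 3168 ∷ + 5760 ∷ + 3800 ∷ + 1080 ∷ + 112 ∷ []) , field₁ , (0 ∷ 0 ∷ 2 ∷ 0 ∷ 1 ∷ 3 ∷ []))
  ∷ ((+ 72 ∷ + 72 ∷ + 22 ∷ + 2 ∷ []) , field₁ , (0 ∷ 0 ∷ 4 ∷ 0 ∷ 1 ∷ 2 ∷ []))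
  ∷ ((+ 6912 ∷ - + 9024 ∷ - + 50848 ∷ - + 53856 ∷ - + 22144 ∷ - + 3200 ∷ []) , field₁ , (0 ∷ 1 ∷ 1 ∷ 0 ∷ 0 ∷ 4 ∷ []))
  ∷ ((+ 4912 ∷ + 8800 ∷ + 5884 ∷ + 1740 ∷ + 192 ∷ []) , field₁ , (0 ∷ 1 ∷ 3 ∷ 0 ∷ 0 ∷ 3 ∷ []))
  ∷ ((- + 4428 ∷ - + 10476 ∷ - + 9759 ∷ - + 4476 ∷ - + 1011 ∷ - + 90 ∷ []) , field₁ , (1 ∷ 0 ∷ 2 ∷ 0 ∷ 2 ∷ 2 ∷ []))
  ∷ ((- + 9600 ∷ - + 44800 ∷ - + 76000 ∷ - + 60000 ∷ - + 22400 ∷ - + 3200 ∷ []) , field₁ , (1 ∷ 0 ∷ 0 ∷ 1 ∷ 0 ∷ 4 ∷ []))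
  ∷ ((+ 108 ∷ + 162 ∷ + 90 ∷ + 22 ∷ + 2 ∷ []) , field₁ , (1 ∷ 0 ∷ 4 ∷ 1 ∷ 0 ∷ 2 ∷ []))
  ∷ ((+ 2808 ∷ + 5328 ∷ + 3966 ∷ + 1446 ∷ + 258 ∷ + 18 ∷ []) , field₁ , (1 ∷ 1 ∷ 3 ∷ 0 ∷ 1 ∷ 2 ∷ []))
  ∷ ((+ 17280 ∷ + 55680 ∷ + 70240 ∷ + 43520 ∷ + 13280 ∷ + 1600 ∷ []) , field₁ , (2 ∷ 0 ∷ 1 ∷ 0 ∷ 0 ∷ 4 ∷ []))
  ∷ ((+ 1020 ∷ + 1732 ∷ + 1091 ∷ + 302 ∷ + 31 ∷ []) , field₁ , (2 ∷ 0 ∷ 3 ∷ 0 ∷ 0 ∷ 3 ∷ []))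
  ∷ ((+ 972 ∷ + 2268 ∷ + 2079 ∷ + 936 ∷ + 207 ∷ + 18 ∷ []) , field₁ , (2 ∷ 0 ∷ 2 ∷ 1 ∷ 1 ∷ 2 ∷ []))
  ∷ ((- + 1296 ∷ - + 2484 ∷ - + 1872 ∷ - + 693 ∷ - + 126 ∷ - + 9 ∷ []) , field₁ , (3 ∷ 0 ∷ 3 ∷ 0 ∷ 1 ∷ 2 ∷ []))
  ∷ ((- + 1728 ∷ - + 3456 ∷ - + 2544 ∷ - + 816 ∷ - + 96 ∷ []) , field₂ , (0 ∷ 0 ∷ 2 ∷ 0 ∷ 2 ∷ 2 ∷ []))
  ∷ ((+ 38400 ∷ + 179200 ∷ + 304000 ∷ + 240000 ∷ + 89600 ∷ + 12800 ∷ []) , field₂ , (0 ∷ 0 ∷ 0 ∷ 1 ∷ 0 ∷ 4 ∷ []))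
  ∷ ((- + 108 ∷ - + 162 ∷ - + 90 ∷ - + 22 ∷ - + 2 ∷ []) , field₂ , (0 ∷ 0 ∷ 4 ∷ 1 ∷ 0 ∷ 2 ∷ []))
  ∷ ((- + 864 ∷ - + 1440 ∷ - + 888 ∷ - + 240 ∷ - + 24 ∷ []) , field₂ , (0 ∷ 1 ∷ 3 ∷ 0 ∷ 1 ∷ 2 ∷ []))
  ∷ ((- + 11520 ∷ - + 40320 ∷ - + 55360 ∷ - + 37280 ∷ - + 12320 ∷ - + 1600 ∷ []) , field₂ , (1 ∷ 0 ∷ 1 ∷ 0 ∷ 0 ∷ 4 ∷ []))
  ∷ ((- + 2640 ∷ - + 4432 ∷ - + 2756 ∷ - + 752 ∷ - + 76 ∷ []) , field₂ , (1 ∷ 0 ∷ 3 ∷ 0 ∷ 0 ∷ 3 ∷ []))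
  ∷ ((- + 3888 ∷ - + 9072 ∷ - + 8316 ∷ - + 3744 ∷ - + 828 ∷ - + 72 ∷ []) , field₂ , (1 ∷ 0 ∷ 2 ∷ 1 ∷ 1 ∷ 2 ∷ []))
  ∷ ((+ 1296 ∷ + 2484 ∷ + 1872 ∷ + 693 ∷ + 126 ∷ + 9 ∷ []) , field₂ , (2 ∷ 0 ∷ 3 ∷ 0 ∷ 1 ∷ 2 ∷ []))
  ∷ []

-- inj₁ j and inj₂ j refer to form-I and form-II with n replaced by n + j.
elimination : List (Poly × (ℕ ⊎ ℕ))
elimination =
    ((+ 420649600 ∷ + 852128000 ∷ + 714219744 ∷ + 317045952 ∷ + 78622304 ∷ + 10329088 ∷ + 561792 ∷ []) , inj₁ 0)
  ∷ ((+ 15395968 ∷ + 32587008 ∷ + 28420736 ∷ + 13079200 ∷ + 3351272 ∷ + 453552 ∷ + 25344 ∷ []) , inj₁ 1)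
  ∷ ((- + 45312 ∷ - + 94208 ∷ - + 80656 ∷ - + 36408 ∷ - + 9140 ∷ - + 1210 ∷ - + 66 ∷ []) , inj₁ 2)
  ∷ ((- + 996800 ∷ - + 1225600 ∷ - + 559552 ∷ - + 112640 ∷ - + 8448 ∷ []) , inj₂ 0)
  ∷ ((- + 3304 ∷ - + 5060 ∷ - + 2870 ∷ - + 715 ∷ - + 66 ∷ []) , inj₂ 1)
  ∷ []

-- Relations and reflection on symbolic monomials

addTerm : ∀ {n} → Poly → Vec ℕ n → Terms n → List (Poly × Vec ℕ n)
addTerm p κ = List.map (λ (c , β) → scaleP c p , zipWith _+ℕ_ κ β)

-- Keys count the exponent of e₃ from 2n − 1, as differentiating e₃²ⁿ lowers it by one.
exponent : Vec ℕ 6 → Fin 6 → Poly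
exponent κ (suc (suc zero)) = + lookup κ (suc (suc zero)) - + 1 ∷ + 2 ∷ []
exponent κ i                = + lookup κ i ∷ []

relationForm : VectorField 6 × Vec ℕ 6 → Monomial.Form
relationForm (F , a ∷ b ∷ s ∷ c ∷ d ∷ u ∷ []) =
  -- The polynomial order - 5 - n is -(m - order) at m = n + 5: the left side of `relation` is moved
  -- to the right.
  addTerm (+ order - + 5 ∷ - + 1 ∷ []) κ powerSum
  ++ List.concatMap (λ i → addTerm (exponent κ i) (lower i κ) (image (suc (toℕ i)))) (List.allFin 6)
  where
  open VectorField F
  -- The successor converts an e₃-exponent counted from 2n into one counted from 2n - 1.
  κ = a ∷ b ∷ suc s ∷ c ∷ d ∷ u ∷ []

-- Under the reflection the exponents of e₁, …, e₅ and both exponents of e₆ add up to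
-- 2(n + 5) = 11 + (2n − 1).
swap : Vec ℕ 6 → Vec ℕ 6
swap (a ∷ b ∷ s ∷ c ∷ d ∷ u ∷ []) with (a +ℕ b +ℕ s +ℕ c +ℕ d +ℕ u) ℕₚ.≤? 11
... | yes _ = d ∷ c ∷ s ∷ b ∷ a ∷ 11 ∸ (a +ℕ b +ℕ s +ℕ c +ℕ d +ℕ u) ∷ []
-- Here the mirror image would have a negative exponent of e₆, which truncated subtraction would
-- falsify.
... | no  _ = a ∷ b ∷ s ∷ c ∷ d ∷ u ∷ []

-- Of a mirror pair it keeps the key whose (a, b) is lexicographically larger than (d, c). In total
-- degree 6(n + 5), a tie means that the key is its own mirror image.
canonical : Vec ℕ 6 → Vec ℕ 6
canonical κ@(a ∷ b ∷ s ∷ c ∷ d ∷ u ∷ []) =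
  if (a ℕ.<ᵇ d) ∨ ((a ℕ.≡ᵇ d) ∧ (b ℕ.<ᵇ c)) then swap κ else κ

-- a(n+j) is a coefficient at index n + j and b(n+j) one at n + j + 1, so 5 - j and 4 - j factors e₆
-- lift them to n + 5. The e₃-exponent 2(n+j) is 2j + 1 when counted from 2n - 1.
key : ℕ ⊎ ℕ → Vec ℕ 6
key (inj₁ j) = 0 ∷ 0 ∷ suc (2 ℕ.* j) ∷ 0 ∷ 0 ∷ 5 ∸ j ∷ []
key (inj₂ j) = 0 ∷ 1 ∷ suc (2 ℕ.* j) ∷ 1 ∷ 0 ∷ 4 ∸ j ∷ []

keyForm : Linear.Form → Monomial.Form
keyForm = List.map (λ (p , k) → p , key k)

opaque
  unfolding U

  U-e₃ : ∀ n → U (+ n) (0 ∷ 0 ∷ 2 ℕ.* n ∷ 0 ∷ 0 ∷ 0 ∷ []) ≡ + a n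
  U-e₃ n = trans
    (coeff-cong (+ n) (solve 1 (λ y → :con 1 :* (:con 1 :* (y :* (:con 1 :* (:con 1 :* (:con 1 :* :con 1))))) := y)
      ≈-refl (e (vars {6}) 3 ^ (2 ℕ.* n))))
    (sym (a-coeff n))
    where
    open import Algebra.Solver.Ring.NaturalCoefficients.Default (commutativeSemiring {6})
      using (solve; _:=_; _:*_) renaming (con to :con)

-- Here n = k + 1. Positivity of n makes 2n - 1 the natural number `suc (k +ℕ k)`, from which keys
-- count.
module Instance (k : ℕ) where

  x : ℤ
  x = + suc k

  place : Vec ℕ 6 → Vec ℕ 6
  place (a ∷ b ∷ s ∷ c ∷ d ∷ u ∷ []) = a ∷ b ∷ s +ℕ suc (k +ℕ k) ∷ c ∷ d ∷ u ∷ []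

  V : Vec ℕ 6 → ℤ
  V κ = U (x + + 5) (place κ)

  value-addTerm : ∀ p κ ts → Monomial.value V x (addTerm p κ ts) ≡ ev p x * evalᵗ (shifted (U (x + + 5)) (place κ)) ts
  value-addTerm p κ []             = sym (ℤₚ.*-zeroʳ (ev p x))
  value-addTerm p κ ((c , β) ∷ ts) = begin
    ev (scaleP c p) x * V (zipWith _+ℕ_ κ β) + Monomial.value V x (addTerm p κ ts)
      ≡⟨ cong₂ _+_ (cong₂ _*_ (ev-scaleP c p x) (cong (U (x + + 5)) (place-+ κ β))) (value-addTerm p κ ts) ⟩
    c * ev p x * shifted (U (x + + 5)) (place κ) β + ev p x * evalᵗ (shifted (U (x + + 5)) (place κ)) ts
      ≡⟨ lem c (ev p x) (shifted (U (x + + 5)) (place κ) β) _ ⟩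
    ev p x * (c * shifted (U (x + + 5)) (place κ) β + evalᵗ (shifted (U (x + + 5)) (place κ)) ts) ∎
    where
    open ≡-Reasoning
    lem : ∀ c p v y → c * p * v + p * y ≡ p * (c * v + y)
    lem = solve-∀
    comm₃ : ∀ a b c → (a +ℕ b) +ℕ c ≡ (a +ℕ c) +ℕ b
    comm₃ = ℕ-Solver.solve-∀
    place-+ : ∀ κ β → place (zipWith _+ℕ_ κ β) ≡ zipWith _+ℕ_ (place κ) β
    place-+ (a ∷ b ∷ s ∷ c ∷ d ∷ u ∷ []) (a′ ∷ b′ ∷ s′ ∷ c′ ∷ d′ ∷ u′ ∷ []) =
      cong (λ t → a +ℕ a′ ∷ b +ℕ b′ ∷ t ∷ c +ℕ c′ ∷ d +ℕ d′ ∷ u +ℕ u′ ∷ []) (comm₃ s s′ (suc (k +ℕ k)))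

  value-concatMap : ∀ {n} (f : Fin n → Monomial.Form) →
                    Monomial.value V x (List.concatMap f (List.allFin n)) ≡ sum (λ i → Monomial.value V x (f i))
  value-concatMap f = trans (cong (λ fs → Monomial.value V x (List.concat fs)) (Listₚ.map-tabulate (λ i → i) f)) (go f)
    where
    go : ∀ {n} (f : Fin n → Monomial.Form) →
         Monomial.value V x (List.concat (List.tabulate f)) ≡ sum (λ i → Monomial.value V x (f i))
    go {zero}  f = refl
    go {suc n} f = trans (Monomial.value-++ V x (f zero) (List.concat (List.tabulate (f ∘ suc))))
      (cong (λ z → Monomial.value V x (f zero) + z) (go (f ∘ suc)))

  relationForm-vanishes : ∀ r → Monomial.value V x (relationForm r) ≡ + 0
  relationForm-vanishes (F , a ∷ b ∷ s ∷ c ∷ d ∷ u ∷ []) = begin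
    Monomial.value V x (left ++ right)
      ≡⟨ Monomial.value-++ V x left right ⟩
    Monomial.value V x left + Monomial.value V x right
      ≡⟨ cong₂ _+_ (value-addTerm (+ order - + 5 ∷ - + 1 ∷ []) κ powerSum)
           (trans (value-concatMap (λ i → addTerm (exponent κ i) (lower i κ) (image (suc (toℕ i)))))
             (sum-cong-≗ (λ i → trans (value-addTerm (exponent κ i) (lower i κ) (image (suc (toℕ i))))
               (cong₂ (λ y α → y * evalᵗ (shifted (U m) α) (image (suc (toℕ i)))) (exponent-value i) (place-lower i))))) ⟩
    ((+ order - + 5) + x * (- + 1 + x * + 0)) * S
      + sum (λ i → + lookup (place κ) i * evalᵗ (shifted (U m) (lower i (place κ))) (image (suc (toℕ i))))
      ≡⟨ cong (λ z → ((+ order - + 5) + x * (- + 1 + x * + 0)) * S + z) (relation F m (place κ)) ⟨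
    ((+ order - + 5) + x * (- + 1 + x * + 0)) * S + (m - + order) * S
      ≡⟨ lem (+ order) x S ⟩
    + 0 ∎
    where
    open ≡-Reasoning
    open VectorField F
    κ = a ∷ b ∷ suc s ∷ c ∷ d ∷ u ∷ []
    m = x + + 5
    S = evalᵗ (shifted (U m) (place κ)) powerSum
    left = addTerm (+ order - + 5 ∷ - + 1 ∷ []) κ powerSum
    right = List.concatMap (λ i → addTerm (exponent κ i) (lower i κ) (image (suc (toℕ i)))) (List.allFin 6)
    lem : ∀ o x s → ((o - + 5) + x * (- + 1 + x * + 0)) * s + (x + + 5 - o) * s ≡ + 0
    lem = solve-∀
    const-value : ∀ y x → y + x * + 0 ≡ y
    const-value = solve-∀
    e₃-value : ∀ s k → (+ 1 + s - + 1) + (+ 1 + k) * (+ 2 + (+ 1 + k) * + 0) ≡ (+ 1 + s) + (+ 1 + (k + k))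
    e₃-value = solve-∀
    exponent-value : ∀ i → ev (exponent κ i) x ≡ + lookup (place κ) i
    exponent-value zero                                = const-value (+ a) x
    exponent-value (suc zero)                          = const-value (+ b) x
    exponent-value (suc (suc zero))                    = e₃-value (+ s) (+ k)
    exponent-value (suc (suc (suc zero)))              = const-value (+ c) x
    exponent-value (suc (suc (suc (suc zero))))        = const-value (+ d) x
    exponent-value (suc (suc (suc (suc (suc zero)))))  = const-value (+ u) x
    place-lower : ∀ i → place (lower i κ) ≡ lower i (place κ)
    place-lower zero                                = refl
    place-lower (suc zero)                          = refl
    place-lower (suc (suc zero))                    = refl
    place-lower (suc (suc (suc zero)))              = refl
    place-lower (suc (suc (suc (suc zero))))        = refl
    place-lower (suc (suc (suc (suc (suc zero)))))  = refl

  V-swap : ∀ κ → V (swap κ) ≡ V κ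
  V-swap (a ∷ b ∷ s ∷ c ∷ d ∷ u ∷ []) with (a +ℕ b +ℕ s +ℕ c +ℕ d +ℕ u) ℕₚ.≤? 11
  ... | no  _  = refl
  ... | yes le = sym (U-dual (x + + 5) a b (s +ℕ suc (k +ℕ k)) c d u (11 ∸ A) (begin
    x + + 5 - + a - + b - + (s +ℕ suc (k +ℕ k)) - + c - + d - + u
      ≡⟨ lem₁ (+ a) (+ b) (+ s) (+ c) (+ d) (+ u) (+ k) ⟩
    - (x + + 5 - (+ 11 - + A))
      ≡⟨ cong (λ z → - (x + + 5 - z)) (trans (ℤₚ.[+m]-[+n]≡m⊖n 11 A) (ℤₚ.⊖-≥ le)) ⟩
    - (x + + 5 - + (11 ∸ A)) ∎))
    where
    open ≡-Reasoning
    A = a +ℕ b +ℕ s +ℕ c +ℕ d +ℕ u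
    lem₁ : ∀ a b s c d u k → (+ 1 + k) + + 5 - a - b - (s + (+ 1 + (k + k))) - c - d - u
                           ≡ - ((+ 1 + k) + + 5 - (+ 11 - (a + b + s + c + d + u)))
    lem₁ = solve-∀

  V-canonical : ∀ κ → V (canonical κ) ≡ V κ
  V-canonical κ@(a ∷ b ∷ s ∷ c ∷ d ∷ u ∷ []) with (a ℕ.<ᵇ d) ∨ ((a ℕ.≡ᵇ d) ∧ (b ℕ.<ᵇ c))
  ... | true  = V-swap κ
  ... | false = refl

  V-matrices : ∀ j u → j +ℕ u ≡ 5 → V (0 ∷ 0 ∷ suc (2 ℕ.* j) ∷ 0 ∷ 0 ∷ u ∷ []) ≡ unknown (suc k) (inj₁ j)
  V-matrices j u eq = begin
    U (x + + 5) (0 ∷ 0 ∷ t ∷ 0 ∷ 0 ∷ u ∷ [])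
      ≡⟨ U-e₆ (x + + 5) 0 0 t 0 0 u ⟩
    U (x + + 5 - + u) (0 ∷ 0 ∷ t ∷ 0 ∷ 0 ∷ 0 ∷ [])
      ≡⟨ cong₂ (λ m t → U m (0 ∷ 0 ∷ t ∷ 0 ∷ 0 ∷ 0 ∷ []))
           (trans (cong (λ z → x + + z - + u) (sym eq)) (lem x (+ j) (+ u))) (exponents j k) ⟩
    U (+ (suc k +ℕ j)) (0 ∷ 0 ∷ 2 ℕ.* (suc k +ℕ j) ∷ 0 ∷ 0 ∷ 0 ∷ [])
      ≡⟨ U-e₃ (suc k +ℕ j) ⟩
    + a (suc k +ℕ j) ∎
    where
    open ≡-Reasoning
    t = suc (2 ℕ.* j) +ℕ suc (k +ℕ k)
    lem : ∀ x j u → x + (j + u) - u ≡ x + j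
    lem = solve-∀
    exponents : ∀ j k → suc (2 ℕ.* j) +ℕ suc (k +ℕ k) ≡ 2 ℕ.* (suc k +ℕ j)
    exponents = ℕ-Solver.solve-∀

  V-companion : ∀ j u → j +ℕ u ≡ 4 → V (0 ∷ 1 ∷ suc (2 ℕ.* j) ∷ 1 ∷ 0 ∷ u ∷ []) ≡ unknown (suc k) (inj₂ j)
  V-companion j u eq = begin
    U (x + + 5) (0 ∷ 1 ∷ t ∷ 1 ∷ 0 ∷ u ∷ [])
      ≡⟨ U-e₆ (x + + 5) 0 1 t 1 0 u ⟩
    U (x + + 5 - + u) (0 ∷ 1 ∷ t ∷ 1 ∷ 0 ∷ 0 ∷ [])
      ≡⟨ cong (λ m → U m (0 ∷ 1 ∷ t ∷ 1 ∷ 0 ∷ 0 ∷ []))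
           (trans (cong (λ z → x + + suc z - + u) (sym eq)) (lem x (+ j) (+ u))) ⟩
    U (+ suc (suc k +ℕ j)) (0 ∷ 1 ∷ t ∷ 1 ∷ 0 ∷ 0 ∷ [])
      ≡⟨ cong (λ t → U (+ suc (suc k +ℕ j)) (0 ∷ 1 ∷ t ∷ 1 ∷ 0 ∷ 0 ∷ [])) (exponents j k) ⟩
    U (+ suc (suc k +ℕ j)) (0 ∷ 1 ∷ 2 ℕ.* (suc k +ℕ j) ∷ 1 ∷ 0 ∷ 0 ∷ []) ∎
    where
    open ≡-Reasoning
    t = suc (2 ℕ.* j) +ℕ suc (k +ℕ k)
    lem : ∀ x j u → x + (+ 1 + (j + u)) - u ≡ + 1 + (x + j)
    lem = solve-∀
    exponents : ∀ j k → suc (2 ℕ.* j) +ℕ suc (k +ℕ k) ≡ 2 ℕ.* (suc k +ℕ j)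
    exponents = ℕ-Solver.solve-∀

  value-keyForm : ∀ f → All (λ (_ , i) → V (key i) ≡ unknown (suc k) i) f →
                  Monomial.value V x (keyForm f) ≡ Linear.value (unknown (suc k)) x f
  value-keyForm []            []       = refl
  value-keyForm ((p , _) ∷ f) (h ∷ hs) = cong₂ (λ y z → ev p x * y + z) h (value-keyForm f hs)

  form-I-vanishes : Linear.value (unknown (suc k)) x form-I ≡ + 0
  form-I-vanishes = trans
    (sym (value-keyForm form-I (V-matrices 1 4 refl ∷ V-matrices 2 3 refl ∷ V-companion 0 4 refl ∷ V-companion 1 3 refl ∷ [])))
    -- The condition proved by `refl` mentions neither `k` nor `V`: one closed computation covers
    -- every n.
    (Monomial.certificate V x relationForm relationForm-vanishes V-canonical certificate-I (keyForm form-I) refl)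

  form-II-vanishes : Linear.value (unknown (suc k)) x form-II ≡ + 0
  form-II-vanishes = trans
    (sym (value-keyForm form-II
      (V-matrices 0 5 refl ∷ V-matrices 1 4 refl ∷ V-matrices 2 3 refl ∷ V-companion 0 4 refl ∷ V-companion 1 3 refl ∷ V-companion 2 2 refl ∷ [])))
    (Monomial.certificate V x relationForm relationForm-vanishes V-canonical certificate-II (keyForm form-II) refl)

shiftForm : Linear.Form → Linear.Form
shiftForm = List.map λ where
  (p , inj₁ j) → shiftP p , inj₁ (suc j)
  (p , inj₂ j) → shiftP p , inj₂ (suc j)

value-shiftForm : ∀ n x f → Linear.value (unknown n) x (shiftForm f) ≡ Linear.value (unknown (suc n)) (+ 1 + x) f
value-shiftForm n x [] = refl
value-shiftForm n x ((p , inj₁ j) ∷ f) = cong₂ _+_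
  (cong₂ _*_ (ev-shiftP p x) (cong (λ i → + a i) (ℕₚ.+-suc n j))) (value-shiftForm n x f)
value-shiftForm n x ((p , inj₂ j) ∷ f) = cong₂ _+_
  (cong₂ _*_ (ev-shiftP p x) (cong companion (ℕₚ.+-suc n j))) (value-shiftForm n x f)

shiftForms : ℕ → Linear.Form → Linear.Form
shiftForms zero    f = f
shiftForms (suc j) f = shiftForm (shiftForms j f)

shiftForms-vanish : ∀ {f} → (∀ k → Linear.value (unknown (suc k)) (+ suc k) f ≡ + 0) →
                    ∀ j k → Linear.value (unknown (suc k)) (+ suc k) (shiftForms j f) ≡ + 0
shiftForms-vanish     z zero    k = z k
shiftForms-vanish {f} z (suc j) k =
  trans (value-shiftForm (suc k) (+ suc k) (shiftForms j f)) (shiftForms-vanish z j (suc k))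

recurrenceForm : ℕ ⊎ ℕ → Linear.Form
recurrenceForm (inj₁ j) = shiftForms j form-I
recurrenceForm (inj₂ j) = shiftForms j form-II

recurrenceForm-vanishes : ∀ k i → Linear.value (unknown (suc k)) (+ suc k) (recurrenceForm i) ≡ + 0
recurrenceForm-vanishes k (inj₁ j) = shiftForms-vanish Instance.form-I-vanishes j k
recurrenceForm-vanishes k (inj₂ j) = shiftForms-vanish Instance.form-II-vanishes j k

-- The coefficients of the final recurrence

infixl 6 _:+_
infixl 7 _:*_
infix  8 #_

-- One expression serves two purposes: `⟦_⟧` unfolds to the coefficient exactly as it is written in
-- the theorem, and `expand` yields the coefficient list on which the elimination is checked.
data Expr : Set where
  #_        : ℤ → Expr
  :n        : Expr
  _:+_ _:*_ : Expr → Expr → Expr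

⟦_⟧ : Expr → ℤ → ℤ
⟦ # c ⟧    n = c
⟦ :n ⟧     n = n
⟦ p :+ q ⟧ n = ⟦ p ⟧ n + ⟦ q ⟧ n
⟦ p :* q ⟧ n = ⟦ p ⟧ n * ⟦ q ⟧ n

expand : Expr → Poly
expand (# c)    = c ∷ []
expand :n       = + 0 ∷ + 1 ∷ []
expand (p :+ q) = expand p ⊞ expand q
expand (p :* q) = expand p ⊠ expand q

ev-expand : ∀ p n → ev (expand p) n ≡ ⟦ p ⟧ n
ev-expand (# c)    n = lem c n
  where
  lem : ∀ c n → c + n * + 0 ≡ c
  lem = solve-∀
ev-expand :n       n = lem n
  where
  lem : ∀ n → + 0 + n * (+ 1 + n * + 0) ≡ n
  lem = solve-∀
ev-expand (p :+ q) n = trans (ev-⊞ (expand p) (expand q) n) (cong₂ _+_ (ev-expand p n) (ev-expand q n))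
ev-expand (p :* q) n = trans (ev-⊠ (expand p) (expand q) n) (cong₂ _*_ (ev-expand p n) (ev-expand q n))

c₀ c₁ c₂ c₃ c₄ : Expr
c₀ = (# + 51200) :* (# + 2 :* :n :+ # + 7) :* (# + 2 :* :n :+ # + 5) :* (# + 2 :* :n :+ # + 3) 
     :* (# + 2 :* :n :+ # + 1) :* (:n :+ # + 2) :* (:n :+ # + 1)
     :* (# + 33 :* :n :* :n :+ # + 242 :* :n :+ # + 445)
c₁ = (# + 128) :* (# + 2 :* :n :+ # + 7) :* (# + 2 :* :n :+ # + 5) :* (# + 2 :* :n :+ # + 3) :* (:n :+ # + 2)
     :* (# + 7491 :* :n :* :n :* :n :* :n :+ # + 84898 :* :n :* :n :* :n
         :+ # + 351364 :* :n :* :n :+ # + 628997 :* :n :+ # + 414370)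
c₂ = (# + 16) :* (# + 2 :* :n :+ # + 5) :* (# + 2 :* :n :+ # + 7)
     :* (# + 2772 :* :n :* :n :* :n :* :n :* :n :* :n :+ # + 48048 :* :n :* :n :* :n :* :n :* :n
         :+ # + 344379 :* :n :* :n :* :n :* :n :+ # + 1307394 :* :n :* :n :* :n
         :+ # + 2775099 :* :n :* :n :+ # + 3125336 :* :n :+ # + 1460132)
c₃ = (# + 2) :* (# + 2 :* :n :+ # + 7) :* (:n :+ # + 3)
     :* (# + 3201 :* :n :* :n :* :n :* :n :* :n :* :n :+ # + 61886 :* :n :* :n :* :n :* :n :* :n
         :+ # + 497179 :* :n :* :n :* :n :* :n :+ # + 2124170 :* :n :* :n :* :n
         :+ # + 5089654 :* :n :* :n :+ # + 6484024 :* :n :+ # + 3431096)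
c₄ = (:n :+ # + 3) :* (:n :+ # + 4) :* (:n :+ # + 4) :* (:n :+ # + 4) :* (:n :+ # + 4) :* (:n :+ # + 4)
     :* (# + 33 :* :n :* :n :+ # + 176 :* :n :+ # + 236)

recurrence : Linear.Form
recurrence = (expand c₀ , inj₁ 0) ∷ (expand (# - + 1 :* c₁) , inj₁ 1) ∷ (expand c₂ , inj₁ 2)
           ∷ (expand c₃ , inj₁ 3) ∷ (expand (# - + 1 :* c₄) , inj₁ 4) ∷ []

recurrence-vanishes : ∀ k → Linear.value (unknown (suc k)) (+ suc k) recurrence ≡ + 0
recurrence-vanishes k =
  -- The list is 6n + 12, the surplus factor 6(n + 2) left by the elimination; at n = k + 1 it
  -- equals 18 + 6k and can be cancelled.
  ℤₚ.*-cancelˡ-≡ (ev (+ 12 ∷ + 6 ∷ []) n) _ _ {{nonZero}}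
    (trans (sym (Linear.value-scale (unknown (suc k)) n (+ 12 ∷ + 6 ∷ []) recurrence))
      (trans (Linear.certificate (unknown (suc k)) n {canon = λ i → i}
               recurrenceForm (recurrenceForm-vanishes k) (λ _ → refl)
               elimination (Linear.scale (+ 12 ∷ + 6 ∷ []) recurrence) refl)
        (sym (ℤₚ.*-zeroʳ (ev (+ 12 ∷ + 6 ∷ []) n)))))
  where
  n = + suc k
  lem : ∀ k → + 12 + (+ 1 + k) * (+ 6 + (+ 1 + k) * + 0) ≡ + 18 + + 6 * k
  lem = solve-∀
  nonZero : NonZero (ev (+ 12 ∷ + 6 ∷ []) n)
  nonZero = subst NonZero (sym (trans (lem (+ k)) (cong (λ z → + 18 + z) (sym (ℤₚ.pos-* 6 k))))) _

theorem5 : (m : ℕ) → let n = + suc m in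
    (+ 51200) * (+ 2 * n + + 7) * (+ 2 * n + + 5) * (+ 2 * n + + 3) * (+ 2 * n + + 1) * (n + + 2) * (n + + 1)
    * (+ 33 * n * n + + 242 * n + + 445) * (+ a (suc m))
    - (+ 128) * (+ 2 * n + + 7) * (+ 2 * n + + 5) * (+ 2 * n + + 3) * (n + + 2)
    * (+ 7491 * n * n * n * n + + 84898 * n * n * n + + 351364 * n * n + + 628997 * n + + 414370) * (+ a (suc m +ℕ 1))
    + (+ 16) * (+ 2 * n + + 5) * (+ 2 * n + + 7)
    * (+ 2772 * n * n * n * n * n * n + + 48048 * n * n * n * n * n + + 344379 * n * n * n * n + + 1307394 * n * n * n + + 2775099 * n * n + + 3125336 * n + + 1460132) * (+ a (suc m +ℕ 2))
    + (+ 2) * (+ 2 * n + + 7) * (n + + 3)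
    * (+ 3201 * n * n * n * n * n * n + + 61886 * n * n * n * n * n + + 497179 * n * n * n * n + + 2124170 * n * n * n + + 5089654 * n * n + + 6484024 * n + + 3431096) * (+ a (suc m +ℕ 3))
    - (n + + 3) * (n + + 4) * (n + + 4) * (n + + 4) * (n + + 4) * (n + + 4)
    * (+ 33 * n * n + + 176 * n + + 236) * (+ a (suc m +ℕ 4))
    ≡ + 0
theorem5 m = begin
  ⟦ c₀ ⟧ n * A (suc m) - ⟦ c₁ ⟧ n * A (suc m +ℕ 1) + ⟦ c₂ ⟧ n * A (suc m +ℕ 2) + ⟦ c₃ ⟧ n * A (suc m +ℕ 3)
    - ⟦ c₄ ⟧ n * A (suc m +ℕ 4)
    ≡⟨ lem (⟦ c₀ ⟧ n) (⟦ c₁ ⟧ n) (⟦ c₂ ⟧ n) (⟦ c₃ ⟧ n) (⟦ c₄ ⟧ n)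
         (A (suc m)) (A (suc m +ℕ 1)) (A (suc m +ℕ 2)) (A (suc m +ℕ 3)) (A (suc m +ℕ 4)) ⟩
  ⟦ c₀ ⟧ n * A (suc m) + (⟦ # - + 1 :* c₁ ⟧ n * A (suc m +ℕ 1) + (⟦ c₂ ⟧ n * A (suc m +ℕ 2)
    + (⟦ c₃ ⟧ n * A (suc m +ℕ 3) + (⟦ # - + 1 :* c₄ ⟧ n * A (suc m +ℕ 4) + + 0))))
    -- `unknown` reads its first entry as a(n + 0), and n + 0 does not reduce to n.
    ≡⟨ term c₀ (cong A (ℕₚ.+-identityʳ (suc m))) (term (# - + 1 :* c₁) refl (term c₂ refl
         (term c₃ refl (term (# - + 1 :* c₄) refl refl)))) ⟨
  Linear.value (unknown (suc m)) n recurrence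
    ≡⟨ recurrence-vanishes m ⟩
  + 0 ∎
  where
  open ≡-Reasoning
  n = + suc m
  A : ℕ → ℤ
  A i = + a i
  term : ∀ c {y z s t} → y ≡ z → s ≡ t → ev (expand c) n * y + s ≡ ⟦ c ⟧ n * z + t
  term c y≡z s≡t = cong₂ _+_ (cong₂ _*_ (ev-expand c n) y≡z) s≡t
  lem : ∀ c₀ c₁ c₂ c₃ c₄ a₀ a₁ a₂ a₃ a₄ →
        c₀ * a₀ - c₁ * a₁ + c₂ * a₂ + c₃ * a₃ - c₄ * a₄
        ≡ c₀ * a₀ + (- + 1 * c₁ * a₁ + (c₂ * a₂ + (c₃ * a₃ + (- + 1 * c₄ * a₄ + + 0))))
  lem = solve-∀
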